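{- Let $t \geq 0$ and $c \geq 1$ be integers. \textsc{Independent Set} admits a PTAS when restricted to VPG graphs with a representation $\mathcal{R} = (\mathcal{G}, \mathcal{P})$ (given as part of the input) such that: (1) each path in $\mathcal{P}$ has a polynomial (in $|\mathcal{P}|$) number of bends; (2) each grid-edge in $\mathcal{G}$ belongs to at most $t$ paths in $\mathcal{P}$; (3) the horizontal part of each path in $\mathcal{P}$ has length at most $c$.
   Context: All graphs are finite and simple. \textsc{Independent Set} is the problem of finding a maximum-size set of pairwise non-adjacent vertices in a graph $G$; its optimum is $\alpha(G)$. A PTAS for it is a family of algorithms, one for each fixed $0<\varepsilon<1$, running in time polynomial in the input size and returning an independent set of size at least $(1-\varepsilon)\alpha(G)$. A path on a rectangular grid is a simple path made of grid-edges (at least one); a bend is a $90$ degree turn at a grid-point. A graph $G$ is VPG if there is a collection $\mathcal{P}$ of paths on a grid $\mathcal{G}$, in one-to-one correspondence with $V(G)$, such that two distinct vertices are adjacent in $G$ if and only if the corresponding paths share at least one grid-point. The pair $(\mathcal{G},\mathcal{P})$ is a VPG representation of $G$. The horizontal part of a path $P$ is the interval $[x^P_{\min},x^P_{\max}]$ obtained by projecting $P$ onto the horizontal axis; its length is measured in number of grid-edges (grid-steps). In condition (1) the bounding polynomial is fixed. Encoding of a representation: for the grid only the grid-step (length of a grid-edge) is stored. For each path $P\in\mathcal{P}$ one stores (1) the sequence $s(P)$ of the first endpoint, all bend-points in order of appearance, and the last endpoint; (2) for all $P'\neq P$ intersecting $P$, the first intersection point of $P$ with $P'$ when traversing $P$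 from first to last endpoint, sorted in order of appearance; (3) for all such $P'$, the last intersection point of $P$ with $P'$, sorted in order of appearance when traversing $P$ from last to first endpoint. -}

module Defs where

open import Data.Bool using (Bool; true; false; T; T?; if_then_else_)
open import Data.Fin using (Fin; toℕ)
open import Data.Fin.Properties using (all?)
open import Data.Fin.Subset using (Subset; _∈_; ∣_∣; inside; outside)
open import Data.Fin.Subset.Properties using (_∈?_)
open import Data.Integer as ℤ using (ℤ; +_; -[1+_])
open import Data.List using (List; []; _∷_; _++_; [_]; map; filter; find; length; zip; drop; reverse; allFin; tabulate)
open import Data.List.Extrema.Nat using (max)
import Data.List.Membership.DecPropositional as DecMembership
import Data.List.Membership.Propositional as List
open import Data.List.NonEmpty as List⁺ using (List⁺; toList; foldr₁)
open import Data.List.Relation.Binary.Sublist.Propositional using (_⊆_)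
open import Data.List.Relation.Unary.AllPairs using (AllPairs)
open import Data.List.Relation.Unary.Linked using (Linked)
open import Data.List.Relation.Unary.Unique.Propositional using (Unique)
open import Data.Maybe using (just)
open import Data.Nat using (ℕ; suc; _+_; _*_; _≤_)
open import Data.Nat.Binary as ℕᵇ using (ℕᵇ; 2[1+_]; 1+[2_])
open import Data.Product using (Σ-syntax; ∃; ∃-syntax; _×_; _,_; proj₁; proj₂)
open import Data.Product.Properties using (≡-dec)
open import Data.Rational as ℚ using (ℚ; 0ℚ; 1ℚ)
open import Data.Sum using (_⊎_)
open import Data.Vec as Vec using (Vec; _[_]≔_)
open import Function.Bundles using (_⇔_)
open import Relation.Binary.Definitions using (DecidableEquality)
open import Relation.Binary.PropositionalEquality using (_≡_; _≢_)
open import Relation.Nullary using (¬_; Dec; does; ¬?)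
open import Relation.Nullary.Decidable using (_×-dec_; _⊎-dec_; _→-dec_)

------------------------------------------------------------------------
-- Polynomials

-- Coefficients in ℕ, constant term first.  These suffice for upper bounds:
-- every real polynomial is bounded on ℕ by one of them.
Polynomial : Set
Polynomial = List ℕ

eval : Polynomial → ℕ → ℕ
eval []       x = 0
eval (a ∷ as) x = a + x * eval as x

------------------------------------------------------------------------
-- The machine model: WHILE programs over binary trees
-- (N. D. Jones, Computability and Complexity from a Programming
-- Perspective, MIT Press 1997).

infixr 5 _∙_

data Tree : Set where
  nil : Tree
  _∙_ : Tree → Tree → Tree

size : Tree → ℕ
size nil     = 1
size (l ∙ r) = suc (size l + size r)

data Expr (k : ℕ) : Set where
  var  : Fin k → Expr k
  nil  : Expr k
  cons : Expr k → Expr k → Expr k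
  hd   : Expr k → Expr k
  tl   : Expr k → Expr k

infix  6 _≔_
infixr 5 _⨾_

data Command (k : ℕ) : Set where
  _≔_      : Fin k → Expr k → Command k
  _⨾_      : Command k → Command k → Command k
  while    : Expr k → Command k → Command k

Store : ℕ → Set
Store k = Vec Tree k

left right : Tree → Tree
left  nil     = nil
left  (l ∙ r) = l
right nil     = nil
right (l ∙ r) = r

⟦_⟧ : ∀ {k} → Expr k → Store k → Tree
⟦ var x    ⟧ s = Vec.lookup s x
⟦ nil      ⟧ s = nil
⟦ cons d e ⟧ s = ⟦ d ⟧ s ∙ ⟦ e ⟧ s
⟦ hd e     ⟧ s = left (⟦ e ⟧ s)
⟦ tl e     ⟧ s = right (⟦ e ⟧ s)

-- Every operation has unit cost.  Trees can be shared as directed acyclic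
-- graphs, so each operation is a bounded number of pointer manipulations,
-- and polynomial time here coincides with polynomial time on Turing machines.
cost : ∀ {k} → Expr k → ℕ
cost (var x)    = 1
cost nil        = 1
cost (cons d e) = suc (cost d + cost e)
cost (hd e)     = suc (cost e)
cost (tl e)     = suc (cost e)

-- c , s ⇓ s′ in-time m : running c from store s halts in store s′ after
-- exactly m units of time.
infix 3 _,_⇓_in-time_

data _,_⇓_in-time_ {k : ℕ} : Command k → Store k → Store k → ℕ → Set where
  assign : ∀ {x e s} →
           (x ≔ e) , s ⇓ (s [ x ]≔ ⟦ e ⟧ s) in-time suc (cost e)
  seq    : ∀ {c d s s′ s″ m n} →
           c , s ⇓ s′ in-time m →
           d , s′ ⇓ s″ in-time n →
           (c ⨾ d) , s ⇓ s″ in-time (m + n)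
  stop   : ∀ {e c s} →
           ⟦ e ⟧ s ≡ nil →
           while e c , s ⇓ s in-time suc (cost e)
  loop   : ∀ {e c s s′ s″ l r m n} →
           ⟦ e ⟧ s ≡ l ∙ r →
           c , s ⇓ s′ in-time m →
           while e c , s′ ⇓ s″ in-time n →
           while e c , s ⇓ s″ in-time (suc (cost e) + m + n)

record Program : Set where
  field
    extraVariables : ℕ
    body           : Command (suc extraVariables)

-- Variable 0 holds the input at the start and the output at the end; the
-- other variables are initially nil.
_on_outputs_within_ : Program → Tree → Tree → ℕ → Set
P on input outputs output within bound =
  ∃[ s ] ∃[ m ]
    (body , (input Vec.∷ Vec.replicate extraVariables nil) ⇓ s in-time m)
    × Vec.head s ≡ output
    × m ≤ bound
  where open Program P

------------------------------------------------------------------------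
-- Graphs and independent sets

record Graph (n : ℕ) : Set where
  field
    adj     : Fin n → Fin n → Bool
    adj-sym : ∀ u v → adj u v ≡ adj v u
    no-loop : ∀ v → adj v v ≡ false

  Adj : Fin n → Fin n → Set
  Adj u v = T (adj u v)

module _ {n : ℕ} (G : Graph n) where
  open Graph G

  Independent : Subset n → Set
  Independent S = ∀ u → u ∈ S → ∀ v → v ∈ S → ¬ Adj u v

  independent? : ∀ S → Dec (Independent S)
  independent? S =
    all? λ u → (u ∈? S) →-dec all? λ v → (v ∈? S) →-dec ¬? (T? (adj u v))

subsets : ∀ n → List (Subset n)
subsets 0       = [ Vec.[] ]
subsets (suc n) =
  map (outside Vec.∷_) (subsets n) ++ map (inside Vec.∷_) (subsets n)

α : ∀ {n} → Graph n → ℕ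
α {n} G = max 0 (map ∣_∣ (filter (independent? G) (subsets n)))

------------------------------------------------------------------------
-- Grid paths

-- (i , j) is the grid-point in column i and row j, so distances between
-- points are measured in grid-steps.
Point : Set
Point = ℤ × ℤ

_≟ₚ_ : DecidableEquality Point
_≟ₚ_ = ≡-dec ℤ._≟_ ℤ._≟_

open DecMembership _≟ₚ_ using () renaming (_∈?_ to _∈ₚ?_)
open DecMembership (≡-dec _≟ₚ_ _≟ₚ_) using () renaming (_∈?_ to _∈ₑ?_)

GridEdge : Point → Point → Set
GridEdge (i , j) (i′ , j′) = ℤ.∣ i ℤ.- i′ ∣ + ℤ.∣ j ℤ.- j′ ∣ ≡ 1

record GridPath : Set where
  field
    points   : List⁺ Point
    joined   : Linked GridEdge (toList points)
    simple   : Unique (toList points)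
    nonempty : 2 ≤ List⁺.length points

  vertices : List Point
  vertices = toList points

open GridPath using (points; vertices)

-- For consecutive points p, q, r of a grid path: one of the edges pq, qr is
-- vertical and the other is horizontal.
Turn : Point → Point → Point → Set
Turn (i , j) (i′ , j′) (i″ , j″) =
  (i ≡ i′ × j′ ≡ j″) ⊎ (j ≡ j′ × i′ ≡ i″)

turn? : ∀ p q r → Dec (Turn p q r)
turn? (i , j) (i′ , j′) (i″ , j″) =
  ((i ℤ.≟ i′) ×-dec (j′ ℤ.≟ j″)) ⊎-dec ((j ℤ.≟ j′) ×-dec (i′ ℤ.≟ i″))

turns : List Point → List Point
turns (p ∷ q ∷ r ∷ ps) =
  if does (turn? p q r) then q ∷ turns (q ∷ r ∷ ps) else turns (q ∷ r ∷ ps)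
turns _ = []

bends : GridPath → List Point
bends P = turns (vertices P)

corners : GridPath → List Point
corners P = List⁺.head (points P) ∷ bends P ++ [ List⁺.last (points P) ]

edges : GridPath → List (Point × Point)
edges P = zip (vertices P) (drop 1 (vertices P))

-- Edges of a path are traversed in one direction, grid-edges have none.
Uses : Point → Point → GridPath → Set
Uses p q P = ((p , q) List.∈ edges P) ⊎ ((q , p) List.∈ edges P)

uses? : ∀ p q P → Dec (Uses p q P)
uses? p q P = ((p , q) ∈ₑ? edges P) ⊎-dec ((q , p) ∈ₑ? edges P)

xmin xmax : GridPath → ℤ
xmin P = foldr₁ ℤ._⊓_ (List⁺.map proj₁ (points P))
xmax P = foldr₁ ℤ._⊔_ (List⁺.map proj₁ (points P))

_Meets_ : GridPath → GridPath → Set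
P Meets Q = ∃[ p ] (p List.∈ vertices P) × (p List.∈ vertices Q)

------------------------------------------------------------------------
-- VPG representations

-- The grid-points are the integer multiples of the grid-step in the plane:
-- (i , j) : Point lies at (i · gridStep , j · gridStep).
record VPGRepresentation {n : ℕ} (G : Graph n) : Set where
  field
    gridStep   : ℚ
    step>0     : 0ℚ ℚ.< gridStep
    path       : Fin n → GridPath
    represents : ∀ u v → u ≢ v → Graph.Adj G u v ⇔ (path u Meets path v)

-- An intersection list of the path of u, traversed in the given direction:
-- each intersecting path (named by its vertex) occurs once, with its first
-- intersection point along the traversal, in order of appearance.  Paths with
-- the same first intersection point may be listed in any order.
record IsIntersectionList {n : ℕ} (path : Fin n → GridPath) (u : Fin n)
                          (traversal : List Point)
                          (entries : List (Fin n × Point)) : Set where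
  field
    exact    : ∀ v p → ((v , p) List.∈ entries) ⇔
                 (v ≢ u × find (_∈ₚ? vertices (path v)) traversal ≡ just p)
    once     : Unique entries
    inOrder  : AllPairs (λ (_ , p) (_ , q) → p ≡ q ⊎ (p ∷ q ∷ []) ⊆ traversal)
                        entries

record IntersectionLists {n : ℕ} {G : Graph n} (R : VPGRepresentation G) : Set where
  open VPGRepresentation R
  field
    firsts  : Fin n → List (Fin n × Point)
    lasts   : Fin n → List (Fin n × Point)
    firsts✓ : ∀ u → IsIntersectionList path u (vertices (path u)) (firsts u)
    lasts✓  : ∀ u → IsIntersectionList path u (reverse (vertices (path u))) (lasts u)

record InClass (t c : ℕ) (b : Polynomial) {n : ℕ} {G : Graph n}
               (R : VPGRepresentation G) : Set where
  open VPGRepresentation R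
  field
    bends≤  : ∀ u → length (bends (path u)) ≤ eval b n
    load≤   : ∀ p q → GridEdge p q →
              length (filter (λ u → uses? p q (path u)) (allFin n)) ≤ t
    length≤ : ∀ u → xmax (path u) ℤ.- xmin (path u) ℤ.≤ + c

------------------------------------------------------------------------
-- Encodings

encodeList : ∀ {A : Set} → (A → Tree) → List A → Tree
encodeList f []       = nil
encodeList f (x ∷ xs) = f x ∙ encodeList f xs

encodeBool : Bool → Tree
encodeBool false = nil
encodeBool true  = nil ∙ nil

-- ℕᵇ is bijective base 2, so a number takes space logarithmic in its value.
encodeℕᵇ : ℕᵇ → Tree
encodeℕᵇ ℕᵇ.zero  = nil
encodeℕᵇ 2[1+ x ] = encodeBool false ∙ encodeℕᵇ x
encodeℕᵇ 1+[2 x ] = encodeBool true ∙ encodeℕᵇ x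

encodeℕ : ℕ → Tree
encodeℕ n = encodeℕᵇ (ℕᵇ.fromℕ n)

encodeℤ : ℤ → Tree
encodeℤ (+ n)      = encodeBool false ∙ encodeℕ n
encodeℤ (-[1+ n ]) = encodeBool true ∙ encodeℕ (suc n)

encodeℚ : ℚ → Tree
encodeℚ r = encodeℤ (ℚ.↥ r) ∙ encodeℕ (ℚ.↧ₙ r)

encodeSubset : ∀ {n} → Subset n → Tree
encodeSubset S = encodeList encodeBool (Vec.toList S)

encodeGraph : ∀ {n} → Graph n → Tree
encodeGraph {n} G =
  encodeList (encodeList encodeBool)
    (tabulate λ u → tabulate λ v → Graph.adj G u v)

module _ {n : ℕ} {G : Graph n} (R : VPGRepresentation G) where
  open VPGRepresentation R

  encodeCoordinate : ℤ → Tree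
  encodeCoordinate i = encodeℚ ((i ℚ./ 1) ℚ.* gridStep)

  encodePoint : Point → Tree
  encodePoint (i , j) = encodeCoordinate i ∙ encodeCoordinate j

  encodeEntry : Fin n × Point → Tree
  encodeEntry (v , p) = encodeℕ (toℕ v) ∙ encodePoint p

  encodeRepresentation : IntersectionLists R → Tree
  encodeRepresentation L =
    encodeℚ gridStep ∙ encodeList encodePath (allFin n)
    where
    open IntersectionLists L

    encodePath : Fin n → Tree
    encodePath u = encodeList encodePoint (corners (path u))
                 ∙ encodeList encodeEntry (firsts u)
                 ∙ encodeList encodeEntry (lasts u)

  encodeInput : IntersectionLists R → Tree
  encodeInput L = encodeGraph G ∙ encodeRepresentation L

------------------------------------------------------------------------
-- Approximation schemes

RepresentationClass : Set₁
RepresentationClass = ∀ {n} {G : Graph n} → VPGRepresentation G → Set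

fromℕ : ℕ → ℚ
fromℕ k = + k ℚ./ 1

record SolvesIndependentSet (𝒞 : RepresentationClass) (ε : ℚ)
                            (A : Program) (time : Polynomial) : Set where
  field
    solves : ∀ {n} (G : Graph n) (R : VPGRepresentation G) (L : IntersectionLists R) →
             𝒞 R →
             Σ[ S ∈ Subset n ]
               (A on encodeInput R L outputs encodeSubset S
                  within eval time (size (encodeInput R L)))
               × Independent G S
               × (1ℚ ℚ.- ε) ℚ.* fromℕ (α G) ℚ.≤ fromℕ ∣ S ∣

IndependentSetAdmitsPTAS : RepresentationClass → Set
IndependentSetAdmitsPTAS 𝒞 =
  ∀ (ε : ℚ) → 0ℚ ℚ.< ε → ε ℚ.< 1ℚ →
  ∃[ A ] ∃[ time ] SolvesIndependentSet 𝒞 ε A time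

{-# OPTIONS --safe #-}

-- Local search on the graph alone is a PTAS.  The program repeatedly replaces
-- its independent set S by the largest set reachable with ρ moves
-- S ↦ (S ∖ N(v)) ∪ {v}, so the result satisfies |A| ≤ |S ∩ N[A]| for every
-- independent A of size at most ρ.  The representation only enters the analysis.
-- Let O be independent.  Slide a vertical strip of width K ≥ c over the grid:
-- each path lies inside at least K − c strips and touches at most K + c.
-- Within a strip every row meets a bounded number W of paths, so the paths form
-- an interval model of depth W in the vertical direction; measuring height
-- by the number of paths of S and O seen so far, windows of height ρ contain at
-- most ρ paths of O, and the total height of the paths is at most W times their
-- number.
-- Applying local optimality to the paths of O inside each window and summing
-- over all windows and strips gives
-- (ρ − W) (K − c) |O| ≤ (ρ + W) (K + c) |S|.
module Submission where

open import Defs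
open import Algebra.Properties.Semiring.Sum using ()
open import Data.Bool using (Bool; true; false; T; T?; not; _∧_; _∨_; if_then_else_)
open import Data.Bool.Properties using (T-≡; ∨-zeroʳ; ¬-not)
open import Data.Empty using (⊥-elim)
open import Data.Fin as Fin using (Fin; toℕ; fromℕ<)
open import Data.Fin.Patterns
open import Data.Fin.Properties using (toℕ-injective; toℕ-fromℕ<)
open import Data.Fin.Subset using (Subset; ∣_∣; inside; outside; _∈_)
open import Data.Fin.Subset.Properties using (_∈?_; ∣p∣≤n; ∉⊥)
open import Data.Integer as ℤ using (ℤ; +_; -[1+_])
import Data.Integer.Properties as ℤ
open import Data.Integer.Tactic.RingSolver using () renaming (solve-∀ to ℤ-solve-∀)
open import Data.List as List using (List; []; _∷_; [_]; foldl; foldr; length; filter; zip; allFin; tabulate; _ʳ++_)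
open import Data.List.Extrema.Nat using (argmax-all)
open import Data.List.Membership.Propositional using (find)
import Data.List.Membership.Propositional as List
open import Data.List.Membership.Propositional.Properties using (∈-map⁺; ∈-map⁻; ∈-filter⁺; ∈-filter⁻; ∈-allFin)
open import Data.List.NonEmpty as List⁺ using (foldr₁)
import Data.List.Properties as List
open import Data.List.Relation.Unary.All as All using (All; []; _∷_)
import Data.List.Relation.Unary.All.Properties as All
open import Data.List.Relation.Unary.Any as Any using (here; there; any?)
open import Data.List.Relation.Unary.Linked using (Linked; _∷_)
open import Data.Nat hiding (∣_-_∣)
open import Data.Nat.Properties
open import Data.Nat.Tactic.RingSolver using (solve-∀)
open import Data.Product using (∃-syntax; _×_; _,_; proj₁; proj₂)
open import Data.Rational as ℚ using (ℚ; mkℚ; 0ℚ; 1ℚ)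
import Data.Rational.Properties as ℚ
open import Data.Rational.Unnormalised as ℚᵘ using (mkℚᵘ; 1ℚᵘ)
import Data.Rational.Unnormalised.Properties as ℚᵘ
open import Data.Sum as Sum using (_⊎_; inj₁; inj₂)
open import Data.Unit using (tt)
open import Data.Vec as Vec using ([]; _∷_; toList; lookup)
open import Data.Vec.Properties using (length-toList; lookup⇒[]=; []=⇒lookup)
open import Function using (_∘_; id; flip; Equivalence)
open import Level using (0ℓ)
open import Relation.Binary.Core using (Rel)
open import Relation.Binary.Definitions using (Total; Transitive)
open import Relation.Binary.PropositionalEquality hiding ([_])
open import Relation.Nullary using (¬_; Dec; yes; no; does; contradiction)
open import Relation.Nullary.Decidable using (_×-dec_)
open import Relation.Unary using (Decidable)

open Algebra.Properties.Semiring.Sum +-*-semiring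
  using (sum; sum-syntax; ∑-distrib-+; ∑-comm; *-distribˡ-sum; *-distribʳ-sum; sum-cong-≗)
open GridPath using (points; vertices; joined; nonempty)

-- The vertical direction is the obstacle: a path may be arbitrarily tall, so windows of fixed
-- geometric height need not contain any path. Measuring height by the starts seen so far helps
-- twice. A window of fixed length contains boundedly many paths of `O`, however dense the strip is;
-- and although a single path can still be very tall, the average height is bounded, which suffices
-- because the inequalities are summed over all windows anyway.
--
-- Only bounding boxes enter the count. Adjacent paths have overlapping boxes, which is enough to
-- locate the vertices that a swap removes; and a path really meets every row of its box, so the
-- load of the grid-edges limits how many boxes in a strip share a row.
--
-- The constants give both directions the same shape: with `K = c (z + 1)` and `ρ = W (z + 1)` each
-- direction costs a factor `z / (z + 2)`. Since `W` depends only on `t`, `c` and `z`, the number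
-- `ρ` of moves is a constant and all move sequences can be tried in polynomial time.

private variable n : ℕ

-- Running times of commands

infix 3 _from_to_within_

_from_to_within_ : ∀ {k} → Command k → Store k → Store k → ℕ → Set
c from s to s′ within b = ∃[ m ] (c , s ⇓ s′ in-time m) × m ≤ b

-- Testing a variable costs 2: once before each of the `i` runs of the body, and once more when the
-- test fails.
loopTime : ℕ → ℕ → ℕ
loopTime i b = i * (2 + b) + 2

module _ {k : ℕ} where

  within-mono : ∀ {c} {s s′ : Store k} {b b′} → b ≤ b′ →
                c from s to s′ within b → c from s to s′ within b′
  within-mono b≤b′ (m , run , m≤b) = m , run , ≤-trans m≤b b≤b′

  within-cong : ∀ {c} {s s′ : Store k} {a a′} (f : ℕ → ℕ) → a ≡ a′ →
                c from s to s′ within f a → c from s to s′ within f a′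
  within-cong f a≡a′ = within-mono (≤-reflexive (cong f a≡a′))

  within : ∀ {c} {s s′ : Store k} {m} b {_ : T (m ≤ᵇ b)} →
           c , s ⇓ s′ in-time m → c from s to s′ within b
  within {m = m} b {m≤b} run = m , run , ≤ᵇ⇒≤ m b m≤b

  infixr 4 _andThen_

  _andThen_ : ∀ {c d} {s s′ s″ : Store k} {a b} → c from s to s′ within a →
              d from s′ to s″ within b → (c ⨾ d) from s to s″ within (a + b)
  (m , run , m≤a) andThen (n , run′ , n≤b) = m + n , seq run run′ , +-mono-≤ m≤a n≤b

  assigning : ∀ {x e} {s : Store k} →
              (x ≔ e) from s to (s Vec.[ x ]≔ ⟦ e ⟧ s) within suc (cost e)
  assigning = _ , assign , ≤-refl

  module _ {A B : Set} {x c} (σ : List A → B → Store k) (f : B → A → B) {b}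
    (more : ∀ a as acc → ∃[ l ] ∃[ r ] Vec.lookup (σ (a ∷ as) acc) x ≡ l ∙ r)
    (done : ∀ acc → Vec.lookup (σ [] acc) x ≡ nil)
    (step : ∀ a as acc → c from σ (a ∷ as) acc to σ as (f acc a) within b) where

    -- A loop that consumes an encoded list is a left fold. With the store displayed by `σ` as a
    -- function of the remaining list and the accumulator, such a loop needs only a run of its body
    -- on one element.
    while-foldl : ∀ as acc → while (var x) c from σ as acc to σ [] (foldl f acc as)
                    within loopTime (length as) b
    while-foldl []       acc = 2 , stop (done acc) , ≤-refl
    while-foldl (a ∷ as) acc
      with more a as acc | step a as acc | while-foldl as (f acc a)
    ... | _ , _ , eq | m , run , m≤b | n , run′ , n≤ =
      2 + m + n , loop eq run run′ ,
      ≤-trans (+-mono-≤ (+-monoʳ-≤ 2 m≤b) n≤) (≤-reflexive (sym (+-assoc (2 + b) _ 2)))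

-- The local search program

true′ : ∀ {k} → Expr k
true′ = cons nil nil

pattern best = 0F
pattern rows = 1F
pattern rounds = 2F
pattern queue = 3F
pattern found = 4F
pattern todo = 5F
pattern mark = 6F
pattern row = 7F
pattern marker = 8F
pattern cursor = 9F
pattern stack = Fin.suc 9F

merge unstack insert tryRow tryAll explore₁ count uncount better pick : Command 11

-- The language has no conditional, so each inner loop clears its own guard and runs at most once.
-- The order matters: `marker` may set the bit after `row` has cleared it.
merge =
    stack ≔ cons (hd (var cursor)) (var stack)
  ⨾ while (hd (var row)) (stack ≔ cons nil (tl (var stack)) ⨾ row ≔ cons nil (tl (var row)))
  ⨾ while (hd (var marker)) (stack ≔ cons true′ (tl (var stack)) ⨾ marker ≔ cons nil (tl (var marker)))
  ⨾ row ≔ tl (var row) ⨾ cursor ≔ tl (var cursor) ⨾ marker ≔ tl (var marker)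

unstack = cursor ≔ cons (hd (var stack)) (var cursor) ⨾ stack ≔ tl (var stack)

insert = while (var cursor) merge ⨾ while (var stack) unstack ⨾ marker ≔ nil

tryRow =
    row ≔ hd (var todo) ⨾ marker ≔ var mark ⨾ cursor ≔ hd (var queue)
  ⨾ insert
  ⨾ found ≔ cons (var cursor) (var found) ⨾ cursor ≔ nil ⨾ todo ≔ tl (var todo) ⨾ mark ≔ cons nil (var mark)

tryAll =
    -- `mark` is the indicator of the vertex whose row is next; `tryRow` shifts it by one place, so
    -- no vertex numbers have to be computed.
    todo ≔ var rows ⨾ mark ≔ cons true′ nil
  ⨾ while (var todo) tryRow
  ⨾ mark ≔ nil ⨾ queue ≔ tl (var queue)

-- Starting `found` at `queue` keeps the unmoved sets, so that `d` levels cover all sequences of at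
-- most `d` moves.
explore₁ = found ≔ var queue ⨾ while (var queue) tryAll ⨾ queue ≔ var found ⨾ found ≔ nil

explore : ℕ → Command 11
explore zero    = queue ≔ cons (var best) nil
explore (suc d) = explore d ⨾ explore₁

count =
    while (hd (var cursor)) (row ≔ cons nil (var row) ⨾ cursor ≔ cons nil (tl (var cursor)))
  ⨾ cursor ≔ tl (var cursor)

uncount =
    while (hd (var cursor)) (row ≔ tl (var row) ⨾ cursor ≔ cons nil (tl (var cursor)))
  ⨾ cursor ≔ tl (var cursor)

-- The conditional is a loop on the excess of the candidate over the best set,
-- held in unary.
better =
    cursor ≔ hd (var queue) ⨾ while (var cursor) count
  ⨾ cursor ≔ var best ⨾ while (var cursor) uncount
  ⨾ while (var row) (best ≔ hd (var queue) ⨾ row ≔ nil)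
  ⨾ queue ≔ tl (var queue)

pick = while (var queue) better

localSearch : ℕ → Command 11
localSearch d =
    rows ≔ hd (var best) ⨾ best ≔ nil ⨾ row ≔ var rows
  ⨾ while (var row) (best ≔ cons nil (var best) ⨾ row ≔ tl (var row))
  ⨾ rounds ≔ var rows
  ⨾ while (var rounds) (explore d ⨾ pick ⨾ rounds ≔ tl (var rounds))

-- Effect and running time of the commands

isNode : Tree → Bool
isNode nil     = false
isNode (_ ∙ _) = true

-- If f is the adjacency row of v and q marks v, this is (s ∖ N(v)) ∪ {v}.
-- The tree q is read as a bit sequence padded with false.
move : (Fin n → Bool) → Tree → Subset n → Subset n
move f q []      = []
move f q (b ∷ s) =
  (isNode (left q) ∨ (not (f 0F) ∧ b)) ∷ move (f ∘ Fin.suc) (right q) s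

bits : (Fin n → Bool) → Tree
bits f = encodeList encodeBool (tabulate f)

skip : ℕ → Tree → Tree
skip zero    q = q
skip (suc m) q = skip m (right q)

bools : List Bool → Tree
bools = encodeList encodeBool

insertTime : ℕ → ℕ
insertTime n = loopTime n 60 + (loopTime n 8 + 2)

module _ {x g r l m v e : Tree} where

  merge-step : ∀ a b q rest rest′ acc →
    merge from x ∷ g ∷ r ∷ l ∷ m ∷ v ∷ e ∷ (encodeBool a ∙ rest) ∷ q ∷ (encodeBool b ∙ rest′) ∷ acc ∷ []
    to x ∷ g ∷ r ∷ l ∷ m ∷ v ∷ e ∷ rest ∷ right q ∷ rest′
       ∷ (encodeBool (isNode (left q) ∨ (not a ∧ b)) ∙ acc) ∷ [] within 60
  merge-step false b nil           _ _ _ = within 60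
    (seq assign (seq (stop refl) (seq (stop refl)
      (seq assign (seq assign assign)))))
  merge-step false b (nil ∙ _)     _ _ _ = within 60
    (seq assign (seq (stop refl) (seq (stop refl)
      (seq assign (seq assign assign)))))
  merge-step false b ((_ ∙ _) ∙ _) _ _ _ = within 60
    (seq assign (seq (stop refl) (seq (loop refl (seq assign assign) (stop refl))
      (seq assign (seq assign assign)))))
  merge-step true  b nil           _ _ _ = within 60
    (seq assign (seq (loop refl (seq assign assign) (stop refl)) (seq (stop refl)
      (seq assign (seq assign assign)))))
  merge-step true  b (nil ∙ _)     _ _ _ = within 60
    (seq assign (seq (loop refl (seq assign assign) (stop refl)) (seq (stop refl)
      (seq assign (seq assign assign)))))
  merge-step true  b ((_ ∙ _) ∙ _) _ _ _ = within 60
    (seq assign (seq (loop refl (seq assign assign) (stop refl)) (seq (loop refl (seq assign assign) (stop refl))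
      (seq assign (seq assign assign)))))

  while-merge : ∀ (f : Fin n → Bool) q (s : Subset n) acc →
    while (var cursor) merge
      from x ∷ g ∷ r ∷ l ∷ m ∷ v ∷ e ∷ bits f ∷ q ∷ encodeSubset s ∷ bools acc ∷ []
      to x ∷ g ∷ r ∷ l ∷ m ∷ v ∷ e ∷ nil ∷ skip n q ∷ nil ∷ bools (toList (move f q s) ʳ++ acc) ∷ []
      within loopTime n 60
  while-merge f q []      acc = _ , stop refl , ≤-refl
  while-merge f q (b ∷ s) acc
    with merge-step (f 0F) b q (bits (f ∘ Fin.suc)) (encodeSubset s) (bools acc)
       | while-merge (f ∘ Fin.suc) (right q) s ((isNode (left q) ∨ (not (f 0F) ∧ b)) ∷ acc)
  ... | m′ , run , m≤ | n′ , run′ , n≤ =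
    _ , loop refl run run′ , +-mono-≤ (+-monoʳ-≤ 2 m≤) n≤

  insert-runs : ∀ (f : Fin n → Bool) q (s : Subset n) →
    insert
      from x ∷ g ∷ r ∷ l ∷ m ∷ v ∷ e ∷ bits f ∷ q ∷ encodeSubset s ∷ nil ∷ []
      to x ∷ g ∷ r ∷ l ∷ m ∷ v ∷ e ∷ nil ∷ nil ∷ encodeSubset (move f q s) ∷ nil ∷ []
      within insertTime n
  insert-runs {n} f q s = while-merge f q s [] andThen unstacking andThen assigning
    where
    written : List Bool
    written = toList (move f q s)

    σ : List Bool → List Bool → Store 11
    σ bs acc = x ∷ g ∷ r ∷ l ∷ m ∷ v ∷ e ∷ nil ∷ skip n q ∷ bools acc ∷ bools bs ∷ []

    length-written : length (written ʳ++ []) ≡ n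
    length-written = trans (List.length-reverse written) (length-toList (move f q s))

    unstacking : while (var stack) unstack from σ (written ʳ++ []) [] to σ [] written
                   within loopTime n 8
    unstacking = subst₂ (λ bs i → while (var stack) unstack from σ (written ʳ++ []) [] to σ [] bs
                                   within loopTime i 8)
                   (List.reverse-involutive written) length-written
                   (while-foldl σ (λ acc b → b ∷ acc) (λ _ _ _ → _ , _ , refl) (λ _ → refl)
                     (λ _ _ _ → assigning andThen assigning) (written ʳ++ []) [])

encodePool : List (Subset n) → Tree
encodePool = encodeList encodeSubset

encodeRows : List (Fin n → Bool) → Tree
encodeRows = encodeList bits

addMove : Subset n → Tree × List (Subset n) → (Fin n → Bool) → Tree × List (Subset n)
addMove s (e , M) f = nil ∙ e , move f e s ∷ M

addMoves : List (Fin n → Bool) → List (Subset n) → Subset n → List (Subset n)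
addMoves fs M s = proj₂ (foldl (addMove s) ((nil ∙ nil) ∙ nil , M) fs)

expand : List (Fin n → Bool) → List (Subset n) → List (Subset n)
expand fs L = foldl (addMoves fs) L L

tryRowTime tryAllTime : ℕ → ℕ
tryRowTime n = 8 + (insertTime n + 13)
tryAllTime n = 8 + (loopTime n (tryRowTime n) + 5)

explore₁Time : ℕ → ℕ → ℕ
explore₁Time n p = 2 + (loopTime p (tryAllTime n) + 4)

module _ {x r : Tree} (fs : List (Fin n → Bool)) (length-fs : length fs ≡ n) where

  tryAll-runs : ∀ s L M →
    tryAll from x ∷ encodeRows fs ∷ r ∷ encodePool (s ∷ L) ∷ encodePool M ∷ nil ∷ nil ∷ nil ∷ nil ∷ nil ∷ nil ∷ []
      to x ∷ encodeRows fs ∷ r ∷ encodePool L ∷ encodePool (addMoves fs M s) ∷ nil ∷ nil ∷ nil ∷ nil ∷ nil ∷ nil ∷ []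
      within tryAllTime n
  tryAll-runs s L M = assigning andThen assigning andThen trying andThen assigning andThen assigning
    where
    σ : List (Fin n → Bool) → Tree × List (Subset n) → Store 11
    σ fs′ (e , M) = x ∷ encodeRows fs ∷ r ∷ encodePool (s ∷ L) ∷ encodePool M ∷ encodeRows fs′ ∷ e
                      ∷ nil ∷ nil ∷ nil ∷ nil ∷ []

    trying : while (var todo) tryRow from σ fs ((nil ∙ nil) ∙ nil , M)
               to σ [] (foldl (addMove s) ((nil ∙ nil) ∙ nil , M) fs)
               within loopTime n (tryRowTime n)
    trying = within-cong (λ i → loopTime i (tryRowTime n)) length-fs
               (while-foldl σ (addMove s) (λ _ _ _ → _ , _ , refl) (λ _ → refl)
                 (λ f _ (e , _) →
                   assigning andThen assigning andThen assigning andThen insert-runs f e s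
                   andThen assigning andThen assigning andThen assigning andThen assigning)
                 fs _)

  explore₁-runs : ∀ L →
    explore₁ from x ∷ encodeRows fs ∷ r ∷ encodePool L ∷ nil ∷ nil ∷ nil ∷ nil ∷ nil ∷ nil ∷ nil ∷ []
      to x ∷ encodeRows fs ∷ r ∷ encodePool (expand fs L) ∷ nil ∷ nil ∷ nil ∷ nil ∷ nil ∷ nil ∷ nil ∷ []
      within explore₁Time n (length L)
  explore₁-runs L =
    assigning andThen
    while-foldl (λ L M → x ∷ encodeRows fs ∷ r ∷ encodePool L ∷ encodePool M ∷ nil ∷ nil ∷ nil ∷ nil ∷ nil ∷ nil ∷ [])
      (addMoves fs) (λ _ _ _ → _ , _ , refl) (λ _ → refl) (λ s L M → tryAll-runs s L M) L L
    andThen assigning andThen assigning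

unary : ℕ → Tree
unary zero    = nil
unary (suc m) = nil ∙ unary m

keepLarger : ℕ → Subset n → Subset n → Subset n
keepLarger zero    t s = t
keepLarger (suc _) t s = s

-- A tie keeps `t`. Hence a round that finds nothing larger returns its starting set itself, on
-- which `round-progress` relies.
improve : Subset n → Subset n → Subset n
improve t s = keepLarger (∣ s ∣ ∸ ∣ t ∣) t s

betterTime : ℕ → ℕ
betterTime n = 3 + (loopTime n 20 + (2 + (loopTime n 20 + (9 + 3))))

countUp countDown : ℕ → Bool → ℕ
countUp   k b = if b then suc k else k
countDown k b = if b then pred k else k

foldl-countUp : ∀ k (s : Subset n) → foldl countUp k (toList s) ≡ k + ∣ s ∣
foldl-countUp k []            = sym (+-identityʳ k)
foldl-countUp k (outside ∷ s) = foldl-countUp k s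
foldl-countUp k (inside  ∷ s) = trans (foldl-countUp (suc k) s) (sym (+-suc k ∣ s ∣))

foldl-countDown : ∀ k (s : Subset n) → foldl countDown k (toList s) ≡ k ∸ ∣ s ∣
foldl-countDown k []            = refl
foldl-countDown k (outside ∷ s) = foldl-countDown k s
foldl-countDown k (inside  ∷ s) = trans (foldl-countDown (pred k) s) (pred-∸ k ∣ s ∣)
  where
  pred-∸ : ∀ k m → pred k ∸ m ≡ k ∸ suc m
  pred-∸ zero    m = 0∸n≡0 m
  pred-∸ (suc k) m = refl

-- The tail of `nil` is `nil`, as `pred 0` is 0; this makes `uncount` compute a truncated difference
-- when the best set is the larger one.
right-unary : ∀ m → right (unary m) ≡ unary (pred m)
right-unary zero    = refl
right-unary (suc m) = refl

module _ {g r m v e : Tree} where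

  counting : ∀ {x l q c} (s : Subset n) →
    while (var cursor) count
      from x ∷ g ∷ r ∷ l ∷ m ∷ v ∷ e ∷ nil ∷ q ∷ encodeSubset s ∷ c ∷ []
      to x ∷ g ∷ r ∷ l ∷ m ∷ v ∷ e ∷ unary ∣ s ∣ ∷ q ∷ nil ∷ c ∷ []
      within loopTime n 20
  counting {x = x} {l} {q} {c} s =
    subst₂ (λ k i → while (var cursor) count from σ (toList s) 0 to σ [] k within loopTime i 20)
      (foldl-countUp 0 s) (length-toList s)
      (while-foldl σ countUp (λ _ _ _ → _ , _ , refl) (λ _ → refl) step (toList s) 0)
    where
    σ : List Bool → ℕ → Store 11
    σ bs k = x ∷ g ∷ r ∷ l ∷ m ∷ v ∷ e ∷ unary k ∷ q ∷ bools bs ∷ c ∷ []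

    step : ∀ b bs k → count from σ (b ∷ bs) k to σ bs (countUp k b) within 20
    step false bs k = within 20 (seq (stop refl) assign)
    step true  bs k = within 20 (seq (loop refl (seq assign assign) (stop refl)) assign)

  uncounting : ∀ {x l q c} k (s : Subset n) →
    while (var cursor) uncount
      from x ∷ g ∷ r ∷ l ∷ m ∷ v ∷ e ∷ unary k ∷ q ∷ encodeSubset s ∷ c ∷ []
      to x ∷ g ∷ r ∷ l ∷ m ∷ v ∷ e ∷ unary (k ∸ ∣ s ∣) ∷ q ∷ nil ∷ c ∷ []
      within loopTime n 20
  uncounting {x = x} {l} {q} {c} k s =
    subst₂ (λ k′ i → while (var cursor) uncount from σ (toList s) k to σ [] k′ within loopTime i 20)
      (foldl-countDown k s) (length-toList s)
      (while-foldl σ countDown (λ _ _ _ → _ , _ , refl) (λ _ → refl) step (toList s) k)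
    where
    σ : List Bool → ℕ → Store 11
    σ bs k = x ∷ g ∷ r ∷ l ∷ m ∷ v ∷ e ∷ unary k ∷ q ∷ bools bs ∷ c ∷ []

    step : ∀ b bs k → uncount from σ (b ∷ bs) k to σ bs (countDown k b) within 20
    step false bs k = within 20 (seq (stop refl) assign)
    step true  bs k = subst (λ u → uncount from σ (true ∷ bs) k
                        to x ∷ g ∷ r ∷ l ∷ m ∷ v ∷ e ∷ u ∷ q ∷ bools bs ∷ c ∷ [] within 20)
                        (right-unary k)
                        (within 20 (seq (loop refl (seq assign assign) (stop refl)) assign))

  better-runs : ∀ (s : Subset n) L t →
    better
      from encodeSubset t ∷ g ∷ r ∷ encodePool (s ∷ L) ∷ m ∷ v ∷ e ∷ nil ∷ nil ∷ nil ∷ nil ∷ []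
      to encodeSubset (improve t s) ∷ g ∷ r ∷ encodePool L ∷ m ∷ v ∷ e ∷ nil ∷ nil ∷ nil ∷ nil ∷ []
      within betterTime n
  better-runs s L t = assigning andThen counting s andThen assigning andThen uncounting ∣ s ∣ t
    andThen choosing (∣ s ∣ ∸ ∣ t ∣) andThen assigning
    where
    choosing : ∀ k →
      while (var row) (best ≔ hd (var queue) ⨾ row ≔ nil)
        from encodeSubset t ∷ g ∷ r ∷ encodePool (s ∷ L) ∷ m ∷ v ∷ e ∷ unary k ∷ nil ∷ nil ∷ nil ∷ []
        to encodeSubset (keepLarger k t s) ∷ g ∷ r ∷ encodePool (s ∷ L) ∷ m ∷ v ∷ e ∷ nil ∷ nil ∷ nil ∷ nil ∷ []
        within 9
    choosing zero    = within 9 (stop refl)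
    choosing (suc k) = within 9 (loop refl (seq assign assign) (stop refl))

  pick-runs : ∀ (L : List (Subset n)) t →
    pick
      from encodeSubset t ∷ g ∷ r ∷ encodePool L ∷ m ∷ v ∷ e ∷ nil ∷ nil ∷ nil ∷ nil ∷ []
      to encodeSubset (foldl improve t L) ∷ g ∷ r ∷ nil ∷ m ∷ v ∷ e ∷ nil ∷ nil ∷ nil ∷ nil ∷ []
      within loopTime (length L) (betterTime n)
  pick-runs = while-foldl
    (λ L t → encodeSubset t ∷ g ∷ r ∷ encodePool L ∷ m ∷ v ∷ e ∷ nil ∷ nil ∷ nil ∷ nil ∷ [])
    improve (λ _ _ _ → _ , _ , refl) (λ _ → refl) better-runs

length-expand : ∀ (fs : List (Fin n → Bool)) L → length (expand fs L) ≡ length L * suc (length fs)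
length-expand fs L = trans (length-all L L) (sym (*-suc (length L) (length fs)))
  where
  length-addMoves : ∀ fs M s e →
    length (proj₂ (foldl (addMove s) (e , M) fs)) ≡ length fs + length M
  length-addMoves []       M s e = refl
  length-addMoves (f ∷ fs) M s e =
    trans (length-addMoves fs (move f e s ∷ M) s (nil ∙ e)) (+-suc (length fs) (length M))

  length-all : ∀ L M → length (foldl (addMoves fs) M L) ≡ length M + length L * length fs
  length-all []      M = sym (+-identityʳ _)
  length-all (s ∷ L) M = begin
    length (foldl (addMoves fs) (addMoves fs M s) L)      ≡⟨ length-all L _ ⟩
    length (addMoves fs M s) + length L * length fs
      ≡⟨ cong (_+ length L * length fs) (length-addMoves fs M s _) ⟩
    length fs + length M + length L * length fs           ≡⟨ cong (_+ length L * length fs) (+-comm (length fs) _) ⟩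
    length M + length fs + length L * length fs           ≡⟨ +-assoc (length M) _ _ ⟩
    length M + length (s ∷ L) * length fs                 ∎
    where open ≡-Reasoning

neighbourhood : List (Fin n → Bool) → ℕ → Subset n → List (Subset n)
neighbourhood fs zero    s = [ s ]
neighbourhood fs (suc d) s = expand fs (neighbourhood fs d s)

-- This is `(n + 1) ^ d`, a polynomial in `n`, as `d` will depend only on `t`, `c` and `ε`.
poolSize : ℕ → ℕ → ℕ
poolSize n zero    = 1
poolSize n (suc d) = poolSize n d * suc n

exploreTime : ℕ → ℕ → ℕ
exploreTime n zero    = 4
exploreTime n (suc d) = exploreTime n d + explore₁Time n (poolSize n d)

roundTime localSearchTime : ℕ → ℕ → ℕ
roundTime n d = exploreTime n d + (loopTime (poolSize n d) (betterTime n) + 3)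
localSearchTime n d = 7 + (loopTime n 8 + (2 + loopTime n (roundTime n d)))

module _ (fs : List (Fin n → Bool)) (length-fs : length fs ≡ n) where

  length-neighbourhood : ∀ d s → length (neighbourhood fs d s) ≡ poolSize n d
  length-neighbourhood zero    s = refl
  length-neighbourhood (suc d) s = trans (length-expand fs (neighbourhood fs d s))
    (cong₂ (λ k i → k * suc i) (length-neighbourhood d s) length-fs)

  explore-runs : ∀ {r} d s →
    explore d from encodeSubset s ∷ encodeRows fs ∷ r ∷ nil ∷ nil ∷ nil ∷ nil ∷ nil ∷ nil ∷ nil ∷ nil ∷ []
      to encodeSubset s ∷ encodeRows fs ∷ r ∷ encodePool (neighbourhood fs d s)
           ∷ nil ∷ nil ∷ nil ∷ nil ∷ nil ∷ nil ∷ nil ∷ []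
      within exploreTime n d
  explore-runs zero    s = assigning
  explore-runs (suc d) s = explore-runs d s andThen
    within-cong (explore₁Time n) (length-neighbourhood d s)
      (explore₁-runs fs length-fs (neighbourhood fs d s))

  roundResult : ℕ → Subset n → Subset n
  roundResult d s = foldl improve s (neighbourhood fs d s)

  localSearchResult : ℕ → Subset n
  localSearchResult d = foldl (λ s _ → roundResult d s) (Vec.replicate n outside) fs

  localSearch-runs : ∀ d rep →
    localSearch d from (encodeRows fs ∙ rep) ∷ Vec.replicate 10 nil
      to encodeSubset (localSearchResult d) ∷ encodeRows fs ∷ Vec.replicate 9 nil
      within localSearchTime n d
  localSearch-runs d rep =
    assigning andThen assigning andThen assigning andThen clearing andThen assigning andThen looping
    where
    σ₀ : List (Fin n → Bool) → ℕ → Store 11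
    σ₀ fs′ k = encodeSubset (Vec.replicate k outside) ∷ encodeRows fs ∷ nil ∷ nil ∷ nil ∷ nil ∷ nil
                 ∷ encodeRows fs′ ∷ nil ∷ nil ∷ nil ∷ []

    foldl-suc : ∀ fs k → foldl {B = Fin n → Bool} (λ k _ → suc k) k fs ≡ k + length fs
    foldl-suc []       k = sym (+-identityʳ k)
    foldl-suc (_ ∷ fs) k = trans (foldl-suc fs (suc k)) (sym (+-suc k (length fs)))

    clearing : while (var row) (best ≔ cons nil (var best) ⨾ row ≔ tl (var row))
                 from σ₀ fs 0 to σ₀ [] n within loopTime n 8
    clearing = subst₂ (λ k i → while (var row) _ from σ₀ fs 0 to σ₀ [] k within loopTime i 8)
      (trans (foldl-suc fs 0) length-fs) length-fs
      (while-foldl σ₀ (λ k _ → suc k) (λ _ _ _ → _ , _ , refl) (λ _ → refl)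
        (λ _ _ _ → within 8 (seq assign assign)) fs 0)

    σ : List (Fin n → Bool) → Subset n → Store 11
    σ fs′ s = encodeSubset s ∷ encodeRows fs ∷ encodeRows fs′ ∷ Vec.replicate 8 nil

    round-runs : ∀ f fs′ s → (explore d ⨾ pick ⨾ rounds ≔ tl (var rounds))
                   from σ (f ∷ fs′) s to σ fs′ (roundResult d s) within roundTime n d
    round-runs f fs′ s = explore-runs d s
      andThen within-cong (λ k → loopTime k (betterTime n)) (length-neighbourhood d s)
                (pick-runs (neighbourhood fs d s) s)
      andThen assigning

    looping : while (var rounds) (explore d ⨾ pick ⨾ rounds ≔ tl (var rounds))
                from σ fs (Vec.replicate n outside) to σ [] (localSearchResult d)
                within loopTime n (roundTime n d)
    looping = within-cong (λ i → loopTime i (roundTime n d)) length-fs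
      (while-foldl σ (λ s _ → roundResult d s) (λ _ _ _ → _ , _ , refl) (λ _ → refl)
        round-runs fs (Vec.replicate n outside))

-- Local optima

lookup-move : ∀ (f : Fin n → Bool) q s u →
  lookup (move f q s) u ≡ isNode (left (skip (toℕ u) q)) ∨ (not (f u) ∧ lookup s u)
lookup-move f q (b ∷ s) Fin.zero    = refl
lookup-move f q (b ∷ s) (Fin.suc u) = lookup-move (f ∘ Fin.suc) (right q) s u

indicator : ℕ → Tree
indicator zero    = (nil ∙ nil) ∙ nil
indicator (suc i) = nil ∙ indicator i

skip-indicator : ∀ i j → isNode (left (skip j (indicator i))) ≡ (i ≡ᵇ j)
skip-indicator zero    zero    = refl
skip-indicator zero    (suc j) = cong (isNode ∘ left) (skip-nil j)
  where
  skip-nil : ∀ j → skip j nil ≡ nil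
  skip-nil zero    = refl
  skip-nil (suc j) = skip-nil j
skip-indicator (suc i) zero    = refl
skip-indicator (suc i) (suc j) = skip-indicator i j

module _ {s : Subset n} where

  addMoves-all : ∀ {m} (P : Subset n → Set) (h : Fin m → Fin n → Bool) i M → All P M →
    (∀ j → P (move (h j) (indicator (i + toℕ j)) s)) →
    All P (proj₂ (foldl (addMove s) (indicator i , M) (tabulate h)))
  addMoves-all {zero}  P h i M all moves = all
  addMoves-all {suc m} P h i M all moves =
    addMoves-all P (h ∘ Fin.suc) (suc i) _
      (subst (λ k → P (move (h Fin.zero) (indicator k) s)) (+-identityʳ i) (moves Fin.zero) ∷ all)
      (λ j → subst (λ k → P (move (h (Fin.suc j)) (indicator k) s)) (+-suc i (toℕ j)) (moves (Fin.suc j)))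

  addMoves-⊇ : ∀ fs e M {t} → t List.∈ M → t List.∈ proj₂ (foldl (addMove s) (e , M) fs)
  addMoves-⊇ []       e M t∈M = t∈M
  addMoves-⊇ (f ∷ fs) e M t∈M = addMoves-⊇ fs (nil ∙ e) _ (there t∈M)

  move∈addMoves : ∀ {m} (h : Fin m → Fin n → Bool) i M j →
    move (h j) (indicator (i + toℕ j)) s List.∈ proj₂ (foldl (addMove s) (indicator i , M) (tabulate h))
  move∈addMoves h i M Fin.zero = addMoves-⊇ (tabulate (h ∘ Fin.suc)) _ _
    (here (cong (λ k → move (h Fin.zero) (indicator k) s) (+-identityʳ i)))
  move∈addMoves h i M (Fin.suc j) =
    subst (List._∈ proj₂ (foldl (addMove s) (indicator i , M) (tabulate h)))
      (cong (λ k → move (h (Fin.suc j)) (indicator k) s) (sym (+-suc i (toℕ j))))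
      (move∈addMoves (h ∘ Fin.suc) (suc i) _ j)

∣improve∣ : ∀ (t s : Subset n) →
  (improve t s ≡ t × ∣ s ∣ ≤ ∣ t ∣) ⊎ (improve t s ≡ s × ∣ t ∣ < ∣ s ∣)
∣improve∣ t s with ∣ s ∣ ∸ ∣ t ∣ in eq
... | zero  = inj₁ (refl , m∸n≡0⇒m≤n eq)
... | suc _ = inj₂ (refl , t<s)
  where
  t<s : ∣ t ∣ < ∣ s ∣
  t<s = ≰⇒> λ s≤t → 0≢1+n (trans (sym (m≤n⇒m∸n≡0 s≤t)) eq)

improve-all : ∀ (P : Subset n → Set) {t} L → P t → All P L → P (foldl improve t L)
improve-all P []      pt all        = pt
improve-all P {t} (s ∷ L) pt (ps ∷ all) with improve t s | ∣improve∣ t s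
... | _ | inj₁ (refl , _) = improve-all P L pt all
... | _ | inj₂ (refl , _) = improve-all P L ps all

foldl-improve-≥ : ∀ (t : Subset n) L →
  (foldl improve t L ≡ t ⊎ ∣ t ∣ < ∣ foldl improve t L ∣)
  × All (λ s → ∣ s ∣ ≤ ∣ foldl improve t L ∣) L
foldl-improve-≥ t []      = inj₁ refl , []
foldl-improve-≥ t (s ∷ L) with improve t s | ∣improve∣ t s
... | _ | inj₁ (refl , s≤t) with foldl-improve-≥ t L
...   | inj₁ eq , all = inj₁ eq , ≤-trans s≤t (≤-reflexive (cong ∣_∣ (sym eq))) ∷ all
...   | inj₂ lt , all = inj₂ lt , ≤-trans s≤t (<⇒≤ lt) ∷ all
foldl-improve-≥ t (s ∷ L) | _ | inj₂ (refl , t<s) with foldl-improve-≥ s L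
...   | inj₁ eq , all = inj₂ (<-≤-trans t<s (≤-reflexive (cong ∣_∣ (sym eq)))) , ≤-reflexive (cong ∣_∣ (sym eq)) ∷ all
...   | inj₂ lt , all = inj₂ (<-trans t<s lt) , <⇒≤ lt ∷ all

LocallyOptimal : List (Fin n → Bool) → ℕ → Subset n → Set
LocallyOptimal fs d s = All (λ t → ∣ t ∣ ≤ ∣ s ∣) (neighbourhood fs d s)

module _ (fs : List (Fin n → Bool)) (length-fs : length fs ≡ n) (d : ℕ) where

  -- A round either returns its start, which is thereby certified as optimal, or gains at least one
  -- vertex; the gain is impossible from a start that is already optimal.
  round-progress : ∀ k s → LocallyOptimal fs d s ⊎ k ≤ ∣ s ∣ →
    let r = roundResult fs length-fs d s in LocallyOptimal fs d r ⊎ suc k ≤ ∣ r ∣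
  round-progress k s opt⊎k≤ with foldl-improve-≥ s (neighbourhood fs d s)
  ... | inj₁ eq , all = inj₁ (subst (LocallyOptimal fs d) (sym eq)
                          (All.map (λ le → ≤-trans le (≤-reflexive (cong ∣_∣ eq))) all))
  ... | inj₂ lt , all with opt⊎k≤
  ...   | inj₂ k≤  = inj₂ (≤-<-trans k≤ lt)
  ...   | inj₁ opt = ⊥-elim (<⇒≱ lt (improve-all (λ t → ∣ t ∣ ≤ ∣ s ∣) (neighbourhood fs d s) ≤-refl opt))

  rounds-progress : ∀ {A : Set} (xs : List A) k s → LocallyOptimal fs d s ⊎ k ≤ ∣ s ∣ →
    let r = foldl (λ s _ → roundResult fs length-fs d s) s xs in
    LocallyOptimal fs d r ⊎ k + length xs ≤ ∣ r ∣
  rounds-progress []       k s h = subst (λ m → LocallyOptimal fs d s ⊎ m ≤ ∣ s ∣) (sym (+-identityʳ k)) h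
  rounds-progress (_ ∷ xs) k s h =
    Sum.map₂ (≤-trans (≤-reflexive (+-suc k (length xs))))
      (rounds-progress xs (suc k) _ (round-progress k s h))

  localSearch-optimal : LocallyOptimal fs d (localSearchResult fs length-fs d)
  localSearch-optimal with rounds-progress fs 0 (Vec.replicate n outside) (inj₂ z≤n)
  ... | inj₁ opt = opt
  -- If every round gained, the set has at least `n` vertices, and no subset is larger.
  ... | inj₂ n≤  = All.universal
    (λ t → ≤-trans (∣p∣≤n t) (≤-trans (≤-reflexive (sym length-fs)) n≤)) _

-- Moves and local optima in a graph

module _ (𝔾 : Graph n) where
  open Graph 𝔾

  adjacency : List (Fin n → Bool)
  adjacency = tabulate adj

  length-adjacency : length adjacency ≡ n
  length-adjacency = List.length-tabulate adj

  swapIn : Fin n → Subset n → Subset n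
  swapIn v s = move (adj v) (indicator (toℕ v)) s

  lookup-swapIn : ∀ v s u →
    lookup (swapIn v s) u ≡ (toℕ v ≡ᵇ toℕ u) ∨ (not (adj v u) ∧ lookup s u)
  lookup-swapIn v s u = trans (lookup-move (adj v) (indicator (toℕ v)) s u)
    (cong (_∨ (not (adj v u) ∧ lookup s u)) (skip-indicator (toℕ v) (toℕ u)))

  ∈-swapIn⁻ : ∀ {v s u} → u ∈ swapIn v s → v ≡ u ⊎ (¬ Adj v u × u ∈ s)
  ∈-swapIn⁻ {v} {s} {u} u∈ with toℕ v ≡ᵇ toℕ u in eq | adj v u | lookup s u in s[u]
                              | trans (sym (lookup-swapIn v s u)) ([]=⇒lookup u∈)
  ... | true  | _     | _    | _ = inj₁ (toℕ-injective (≡ᵇ⇒≡ (toℕ v) (toℕ u) (subst T (sym eq) tt)))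
  ... | false | false | true | _ = inj₂ ((λ ()) , lookup⇒[]= u s s[u])

  swapIn-new : ∀ v s → v ∈ swapIn v s
  swapIn-new v s = lookup⇒[]= v _ (trans (lookup-swapIn v s v)
    (cong (_∨ (not (adj v v) ∧ lookup s v)) (Equivalence.to T-≡ (≡⇒≡ᵇ (toℕ v) (toℕ v) refl))))

  swapIn-old : ∀ {v s u} → ¬ Adj v u → u ∈ s → u ∈ swapIn v s
  swapIn-old {v} {s} {u} ¬vu u∈s = lookup⇒[]= u _ (trans (lookup-swapIn v s u)
    (trans (cong₂ (λ a b → _ ∨ (not a ∧ b)) (¬-not (¬vu ∘ Equivalence.from T-≡)) ([]=⇒lookup u∈s))
           (∨-zeroʳ _)))

  -- A move deletes the neighbours of the vertex that it adds. So the search, started at the empty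
  -- set, stays among independent sets without ever testing for independence.
  swapIn-independent : ∀ v {s} → Independent 𝔾 s → Independent 𝔾 (swapIn v s)
  swapIn-independent v {s} ind u u∈ w w∈ uw with ∈-swapIn⁻ {v} {s} u∈ | ∈-swapIn⁻ {v} {s} w∈
  ... | inj₁ refl       | inj₁ refl       = subst T (no-loop v) uw
  ... | inj₁ refl       | inj₂ (¬vw , _)  = ¬vw uw
  ... | inj₂ (¬vu , _)  | inj₁ refl       = ¬vu (subst T (adj-sym u v) uw)
  ... | inj₂ (_ , u∈s)  | inj₂ (_ , w∈s)  = ind u u∈s w w∈s uw

  addMoves-independent : ∀ L M → All (Independent 𝔾) M → All (Independent 𝔾) L →
    All (Independent 𝔾) (foldl (addMoves adjacency) M L)
  addMoves-independent []      M allM []         = allM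
  addMoves-independent (s ∷ L) M allM (ps ∷ allL) = addMoves-independent L _
    (addMoves-all (Independent 𝔾) adj 0 M allM (λ v → swapIn-independent v ps)) allL

  neighbourhood-independent : ∀ d {s} → Independent 𝔾 s →
    All (Independent 𝔾) (neighbourhood adjacency d s)
  neighbourhood-independent zero    ind = ind ∷ []
  neighbourhood-independent (suc d) ind =
    addMoves-independent _ _ (neighbourhood-independent d ind) (neighbourhood-independent d ind)

  foldl-addMoves-⊇ : ∀ L M {t} → t List.∈ M → t List.∈ foldl (addMoves adjacency) M L
  foldl-addMoves-⊇ []      M t∈M = t∈M
  foldl-addMoves-⊇ (s ∷ L) M t∈M = foldl-addMoves-⊇ L _ (addMoves-⊇ adjacency _ M t∈M)

  swapIn∈foldl-addMoves : ∀ v L M {s} → s List.∈ L → swapIn v s List.∈ foldl (addMoves adjacency) M L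
  swapIn∈foldl-addMoves v (s ∷ L) M (here refl) = foldl-addMoves-⊇ L _ (move∈addMoves adj 0 M v)
  swapIn∈foldl-addMoves v (s ∷ L) M (there s∈)  = swapIn∈foldl-addMoves v L _ s∈

  swaps∈neighbourhood : ∀ d s vs → length vs ≤ d → foldr swapIn s vs List.∈ neighbourhood adjacency d s
  swaps∈neighbourhood zero    s []       _       = here refl
  swaps∈neighbourhood (suc d) s []       _       = foldl-addMoves-⊇ (neighbourhood adjacency d s) _ (swaps∈neighbourhood d s [] z≤n)
  swaps∈neighbourhood (suc d) s (v ∷ vs) (s≤s l) = swapIn∈foldl-addMoves v _ _ (swaps∈neighbourhood d s vs l)

  -- Only a move at a neighbour of `u` deletes `u`. Hence all members of an independent `vs` end up
  -- in the set, together with the members of `s` that have no neighbour in `vs`.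
  ∈-swaps : ∀ {s u} vs → u ∈ s ⊎ u List.∈ vs → (∀ {v} → v List.∈ vs → ¬ Adj v u) → u ∈ foldr swapIn s vs
  ∈-swaps []       (inj₁ u∈s)         _   = u∈s
  ∈-swaps (v ∷ vs) (inj₂ (here refl)) _   = swapIn-new v _
  ∈-swaps (v ∷ vs) (inj₁ u∈s)         ¬vu = swapIn-old (¬vu (here refl)) (∈-swaps vs (inj₁ u∈s) (¬vu ∘ there))
  ∈-swaps (v ∷ vs) (inj₂ (there u∈))  ¬vu = swapIn-old (¬vu (here refl)) (∈-swaps vs (inj₂ u∈) (¬vu ∘ there))

  searchResult : ℕ → Subset n
  searchResult = localSearchResult adjacency length-adjacency

  searchResult-independent : ∀ d → Independent 𝔾 (searchResult d)
  searchResult-independent d = iterated adjacency (λ u u∈⊥ → ⊥-elim (∉⊥ u∈⊥))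
    where
    iterated : ∀ fs {s} → Independent 𝔾 s →
      Independent 𝔾 (foldl (λ s _ → roundResult adjacency length-adjacency d s) s fs)
    iterated []       ind = ind
    iterated (_ ∷ fs) ind = iterated fs
      (improve-all (Independent 𝔾) _ ind (neighbourhood-independent d ind))

  searchResult-swaps : ∀ d vs → length vs ≤ d →
    ∣ foldr swapIn (searchResult d) vs ∣ ≤ ∣ searchResult d ∣
  searchResult-swaps d vs l = All.lookup
    (localSearch-optimal adjacency length-adjacency d) (swaps∈neighbourhood d _ vs l)

-- Double counting

𝟙 : ∀ {P : Set} → Dec P → ℕ
𝟙 p? = if does p? then 1 else 0

# : ∀ {P : Fin n → Set} → Decidable P → ℕ
# P? = ∑[ u < _ ] 𝟙 (P? u)

module _ {P : Set} where

  𝟙-≤ : ∀ (p? : Dec P) {m} → (P → 1 ≤ m) → 𝟙 p? ≤ m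
  𝟙-≤ (yes p) 1≤m = 1≤m p
  𝟙-≤ (no _)  1≤m = z≤n

  1≤𝟙 : ∀ (p? : Dec P) → P → 1 ≤ 𝟙 p?
  1≤𝟙 (yes _) p = ≤-refl
  1≤𝟙 (no ¬p) p = contradiction p ¬p

𝟙-mono : ∀ {P Q : Set} (p? : Dec P) (q? : Dec Q) → (P → Q) → 𝟙 p? ≤ 𝟙 q?
𝟙-mono p? q? p→q = 𝟙-≤ p? (1≤𝟙 q? ∘ p→q)

𝟙-× : ∀ {P Q : Set} (p? : Dec P) (q? : Dec Q) → 𝟙 (p? ×-dec q?) ≡ 𝟙 p? * 𝟙 q?
𝟙-× p? q? with does p? | does q?
... | true  | true  = refl
... | true  | false = refl
... | false | _     = refl

sum-mono : ∀ {f g : Fin n → ℕ} → (∀ i → f i ≤ g i) → sum f ≤ sum g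
sum-mono {zero}  f≤g = z≤n
sum-mono {suc n} f≤g = +-mono-≤ (f≤g Fin.zero) (sum-mono (f≤g ∘ Fin.suc))

term≤sum : ∀ (f : Fin n → ℕ) i → f i ≤ sum f
term≤sum f Fin.zero    = m≤m+n _ _
term≤sum f (Fin.suc i) = ≤-trans (term≤sum (f ∘ Fin.suc) i) (m≤n+m _ _)

sum-const : ∀ n m → ∑[ i < n ] m ≡ n * m
sum-const zero    m = refl
sum-const (suc n) m = cong (λ k → m + k) (sum-const n m)

∑-*-∑ : ∀ {m} (p : Fin m → ℕ) (f : Fin m → Fin n → ℕ) →
  ∑[ u < m ] (p u * ∑[ r < n ] f u r) ≡ ∑[ r < n ] ∑[ u < m ] (p u * f u r)
∑-*-∑ p f = trans (sum-cong-≗ (λ u → *-distribˡ-sum (p u) (f u)))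
                  (∑-comm (λ u r → p u * f u r))

inRange? : ∀ p q r → Dec (p ≤ r × r < q)
inRange? p q r = (p ≤? r) ×-dec (r <? q)

inRange-suc : ∀ p q r → 𝟙 (inRange? (suc p) (suc q) (suc r)) ≡ 𝟙 (inRange? p q r)
inRange-suc p q r = ≤-antisym
  (𝟙-mono (inRange? (suc p) (suc q) (suc r)) (inRange? p q r) (λ { (s≤s p≤r , s≤s r<q) → p≤r , r<q }))
  (𝟙-mono (inRange? p q r) (inRange? (suc p) (suc q) (suc r)) (λ (p≤r , r<q) → s≤s p≤r , s≤s r<q))

inRange-0 : ∀ q r → 𝟙 (inRange? 0 (suc q) (suc r)) ≡ 𝟙 (inRange? 0 q r)
inRange-0 q r = ≤-antisym
  (𝟙-mono (inRange? 0 (suc q) (suc r)) (inRange? 0 q r) (λ { (_ , s≤s r<q) → z≤n , r<q }))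
  (𝟙-mono (inRange? 0 q r) (inRange? 0 (suc q) (suc r)) (λ (_ , r<q) → z≤n , s≤s r<q))

count-inRange-≤ : ∀ N p q → ∑[ r < N ] 𝟙 (inRange? p q (toℕ r)) ≤ q ∸ p
count-inRange-≤ zero    p       q       = z≤n
count-inRange-≤ (suc N) p       zero    = ≤-trans
  (sum-mono {g = λ _ → 0} (λ r → 𝟙-≤ (inRange? p 0 (toℕ {suc N} r)) (λ ())))
  (≤-reflexive (trans (sum-const (suc N) 0) (trans (*-zeroʳ (suc N)) (sym (0∸n≡0 p)))))
count-inRange-≤ (suc N) zero    (suc q) = s≤s (≤-trans
  (≤-reflexive (sum-cong-≗ {N} (λ r → inRange-0 q (toℕ r)))) (count-inRange-≤ N 0 q))
count-inRange-≤ (suc N) (suc p) (suc q) = ≤-trans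
  (≤-reflexive (sum-cong-≗ {N} (λ r → inRange-suc p q (toℕ r)))) (count-inRange-≤ N p q)

count-inRange-≥ : ∀ N p q → q ≤ N → q ∸ p ≤ ∑[ r < N ] 𝟙 (inRange? p q (toℕ r))
count-inRange-≥ N       p       zero    _         = ≤-trans (≤-reflexive (0∸n≡0 p)) z≤n
count-inRange-≥ (suc N) zero    (suc q) (s≤s q≤N) = s≤s (≤-trans (count-inRange-≥ N 0 q q≤N)
  (≤-reflexive (sum-cong-≗ {N} (λ r → sym (inRange-0 q (toℕ r))))))
count-inRange-≥ (suc N) (suc p) (suc q) (s≤s q≤N) = ≤-trans (count-inRange-≥ N p q q≤N)
  (≤-reflexive (sum-cong-≗ {N} (λ r → sym (inRange-suc p q (toℕ r)))))

-- The window ending at r is (r − ℓ , r]: it contains the interval [a , b]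
-- iff b ≤ r < a + ℓ, and meets it iff a ≤ r < b + ℓ.
sum-over-windows : ∀ (a b p q : Fin n → ℕ) ℓ M M′ →
  (∀ r → M * ∑[ u < n ] (p u * 𝟙 (inRange? (b u) (a u + ℓ) r))
       ≤ M′ * ∑[ u < n ] (q u * 𝟙 (inRange? (a u) (b u + ℓ) r))) →
  M * ∑[ u < n ] (p u * (a u + ℓ ∸ b u)) ≤ M′ * ∑[ u < n ] (q u * (b u + ℓ ∸ a u))
sum-over-windows {n} a b p q ℓ M M′ window = begin
  M * ∑[ u < n ] (p u * (a u + ℓ ∸ b u))
    ≤⟨ *-monoʳ-≤ M (sum-mono λ u → *-monoʳ-≤ (p u) (count-inRange-≥ N (b u) (a u + ℓ) (+-monoˡ-≤ ℓ (term≤sum a u)))) ⟩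
  M * ∑[ u < n ] (p u * ∑[ r < N ] 𝟙 (inRange? (b u) (a u + ℓ) (toℕ r)))
    ≡⟨ cong (M *_) (∑-*-∑ {N} p (λ u r → 𝟙 (inRange? (b u) (a u + ℓ) (toℕ r)))) ⟩
  M * ∑[ r < N ] ∑[ u < n ] (p u * 𝟙 (inRange? (b u) (a u + ℓ) (toℕ r)))
    ≡⟨ *-distribˡ-sum {N} M _ ⟩
  ∑[ r < N ] (M * ∑[ u < n ] (p u * 𝟙 (inRange? (b u) (a u + ℓ) (toℕ r))))
    ≤⟨ sum-mono {N} (λ r → window (toℕ r)) ⟩
  ∑[ r < N ] (M′ * ∑[ u < n ] (q u * 𝟙 (inRange? (a u) (b u + ℓ) (toℕ r))))
    ≡⟨ *-distribˡ-sum {N} M′ _ ⟨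
  M′ * ∑[ r < N ] ∑[ u < n ] (q u * 𝟙 (inRange? (a u) (b u + ℓ) (toℕ r)))
    ≡⟨ cong (M′ *_) (∑-*-∑ {N} q (λ u r → 𝟙 (inRange? (a u) (b u + ℓ) (toℕ r)))) ⟨
  M′ * ∑[ u < n ] (q u * ∑[ r < N ] 𝟙 (inRange? (a u) (b u + ℓ) (toℕ r)))
    ≤⟨ *-monoʳ-≤ M′ (sum-mono λ u → *-monoʳ-≤ (q u) (count-inRange-≤ N (a u) (b u + ℓ))) ⟩
  M′ * ∑[ u < n ] (q u * (b u + ℓ ∸ a u)) ∎
  where
  open ≤-Reasoning
  -- Large enough that no window containing some interval is cut off, since `a u + ℓ ≤ N`; on the
  -- right-hand side a cutoff can only lower the count.
  N = sum a + ℓ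

total⇒refl : ∀ {B : Set} {_≼_ : Rel B 0ℓ} → Total _≼_ → ∀ b → b ≼ b
total⇒refl total b with total b b
... | inj₁ b≼b = b≼b
... | inj₂ b≼b = b≼b

least : ∀ {A : Fin n → Set} (A? : Decidable A) {B : Set} {_≼_ : Rel B 0ℓ} →
  Total _≼_ → Transitive _≼_ → (f : Fin n → B) →
  (∀ u → ¬ A u) ⊎ ∃[ u ] A u × (∀ v → A v → f u ≼ f v)
least {zero}  A? total ≼-trans f = inj₁ λ ()
least {suc n} {A} A? {_≼_ = _≼_} total ≼-trans f
  with A? Fin.zero | least (A? ∘ Fin.suc) total ≼-trans (f ∘ Fin.suc)
... | no ¬A | inj₁ none = inj₁ λ { Fin.zero → ¬A ; (Fin.suc u) → none u }
... | no ¬A | inj₂ (u , Au , min) =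
  inj₂ (Fin.suc u , Au , λ { Fin.zero A0 → contradiction A0 ¬A ; (Fin.suc v) → min v })
... | yes A0 | inj₁ none =
  inj₂ (Fin.zero , A0 , λ { Fin.zero _ → total⇒refl total _ ; (Fin.suc v) Av → contradiction Av (none v) })
... | yes A0 | inj₂ (u , Au , min) with total (f Fin.zero) (f (Fin.suc u))
...   | inj₁ 0≼u = inj₂ (Fin.zero , A0 , λ { Fin.zero _ → total⇒refl total _ ; (Fin.suc v) Av → ≼-trans 0≼u (min v Av) })
...   | inj₂ u≼0 = inj₂ (Fin.suc u , Au , λ { Fin.zero _ → u≼0 ; (Fin.suc v) → min v })

-- The sweep through one strip

module Strip
  {P Q : Fin n → Set} (P? : Decidable P) (Q? : Decidable Q)
  (lo hi : Fin n → ℤ) (lo≤hi : ∀ u → lo u ℤ.≤ hi u) (ℓ W : ℕ)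
  (depth : ∀ y → ∑[ u < n ] ((𝟙 (P? u) + 𝟙 (Q? u)) * 𝟙 ((lo u ℤ.≤? y) ×-dec (y ℤ.≤? hi u))) ≤ W)
  -- Local optimality in interval form: overlap of intervals stands in for adjacency, which only
  -- enlarges the set that `B` has to cover.
  (swap : ∀ {A B : Fin n → Set} (A? : Decidable A) (B? : Decidable B) →
          (∀ {u} → A u → P u) → # A? ≤ ℓ →
          (∀ {u v} → A u → Q v → lo u ℤ.≤ hi v → lo v ℤ.≤ hi u → B v) →
          # A? ≤ # B?)
  where

  weight : Fin n → ℕ
  weight u = 𝟙 (P? u) + 𝟙 (Q? u)

  -- Sweeping upwards, the row y is reached when the intervals that start
  -- below y have been seen; in these units the vertex u lives from birth u
  -- to death u, and windows of ℓ units contain at most ℓ vertices.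
  birth death span : Fin n → ℕ
  birth u = ∑[ v < n ] (weight v * 𝟙 (lo v ℤ.<? lo u))
  death   u = ∑[ v < n ] (weight v * 𝟙 (lo v ℤ.≤? hi u))
  span  u = ∑[ v < n ] (weight v * 𝟙 ((lo u ℤ.≤? lo v) ×-dec (lo v ℤ.≤? hi u)))

  weighted-mono : ∀ {A B : Fin n → Set} (A? : Decidable A) (B? : Decidable B) → (∀ v → A v → B v) →
    ∑[ v < n ] (weight v * 𝟙 (A? v)) ≤ ∑[ v < n ] (weight v * 𝟙 (B? v))
  weighted-mono A? B? A⇒B = sum-mono λ v → *-monoʳ-≤ (weight v) (𝟙-mono (A? v) (B? v) (A⇒B v))

  birth≤death : ∀ {u v} → lo u ℤ.≤ hi v → birth u ≤ death v
  birth≤death {u} {v} lo≤hi = weighted-mono (λ w → lo w ℤ.<? lo u) (λ w → lo w ℤ.≤? hi v)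
    λ w w<u → ℤ.≤-trans (ℤ.<⇒≤ w<u) lo≤hi

  death≤birth+span : ∀ u → death u ≤ birth u + span u
  death≤birth+span u = ≤-trans (sum-mono bound) (≤-reflexive (∑-distrib-+ {n} _ _))
    where
    bound : ∀ v → weight v * 𝟙 (lo v ℤ.≤? hi u) ≤
      weight v * 𝟙 (lo v ℤ.<? lo u) + weight v * 𝟙 ((lo u ℤ.≤? lo v) ×-dec (lo v ℤ.≤? hi u))
    bound v = ≤-trans (*-monoʳ-≤ (weight v) (𝟙-≤ (lo v ℤ.≤? hi u) below-or-inside))
                      (≤-reflexive (*-distribˡ-+ (weight v) _ _))
      where
      below-or-inside : lo v ℤ.≤ hi u →
        1 ≤ 𝟙 (lo v ℤ.<? lo u) + 𝟙 ((lo u ℤ.≤? lo v) ×-dec (lo v ℤ.≤? hi u))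
      below-or-inside v≤ with ℤ.≤-total (lo u) (lo v)
      ... | inj₁ u≤v = ≤-trans (1≤𝟙 ((lo u ℤ.≤? lo v) ×-dec (lo v ℤ.≤? hi u)) (u≤v , v≤)) (m≤n+m _ _)
      ... | inj₂ v≤u with lo v ℤ.≟ lo u
      ...   | yes eq = ≤-trans (1≤𝟙 ((lo u ℤ.≤? lo v) ×-dec (lo v ℤ.≤? hi u)) (ℤ.≤-reflexive (sym eq) , v≤)) (m≤n+m _ _)
      ...   | no neq = ≤-trans (1≤𝟙 (lo v ℤ.<? lo u) (ℤ.≤∧≢⇒< v≤u neq)) (m≤m+n _ _)

  Inside Touching : ℕ → Fin n → Set
  Inside   r u = P u × death u ≤ r × r < birth u + ℓ
  Touching r u = Q u × birth u ≤ r × r < death u + ℓ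

  inside? : ∀ r → Decidable (Inside r)
  inside? r u = P? u ×-dec inRange? (death u) (birth u + ℓ) r

  touching? : ∀ r → Decidable (Touching r)
  touching? r u = Q? u ×-dec inRange? (birth u) (death u + ℓ) r

  -- Let `u` be the member that starts first and `v` the one that starts last. Every member starts
  -- between them, so `death v` counts all members on top of `birth u`, while
  -- `death v ≤ r < birth u + ℓ`.
  #inside≤ℓ : ∀ r → # (inside? r) ≤ ℓ
  #inside≤ℓ r with least (inside? r) ℤ.≤-total ℤ.≤-trans lo
                 | least (inside? r) (λ i j → ℤ.≤-total j i) (flip ℤ.≤-trans) lo
  ... | inj₁ none | _ = ≤-trans (sum-mono {g = λ _ → 0} λ u → 𝟙-≤ (inside? r u) (⊥-elim ∘ none u))
                          (≤-trans (≤-reflexive (trans (sum-const n 0) (*-zeroʳ n))) z≤n)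
  ... | inj₂ (u , in-u , _) | inj₁ none = ⊥-elim (none u in-u)
  ... | inj₂ (u , in-u@(_ , _ , r<) , first) | inj₂ (v , in-v@(_ , ≤r , _) , last) =
    +-cancelʳ-≤ (birth u) _ _ (begin
      # (inside? r) + birth u  ≡⟨ ∑-distrib-+ {n} _ _ ⟨
      ∑[ w < n ] (𝟙 (inside? r w) + weight w * 𝟙 (lo w ℤ.<? lo u)) ≤⟨ sum-mono (λ w → case w (inside? r w)) ⟩
      death v                    ≤⟨ ≤r ⟩
      r                        ≤⟨ <⇒≤ r< ⟩
      birth u + ℓ              ≡⟨ +-comm (birth u) ℓ ⟩
      ℓ + birth u              ∎)
    where
    open ≤-Reasoning
    case : ∀ w (in? : Dec (Inside r w)) →
      𝟙 in? + weight w * 𝟙 (lo w ℤ.<? lo u) ≤ weight w * 𝟙 (lo w ℤ.≤? hi v)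
    case w (yes in-w@(Pw , _)) = begin
      1 + weight w * 𝟙 (lo w ℤ.<? lo u)
        ≤⟨ +-monoʳ-≤ 1 (*-monoʳ-≤ (weight w) (𝟙-≤ (lo w ℤ.<? lo u) λ w<u → ⊥-elim (ℤ.<⇒≱ w<u (first w in-w)))) ⟩
      1 + weight w * 0                   ≡⟨ cong suc (*-zeroʳ (weight w)) ⟩
      1 * 1
        ≤⟨ *-mono-≤ (≤-trans (1≤𝟙 (P? w) Pw) (m≤m+n _ _)) (1≤𝟙 (lo w ℤ.≤? hi v) (ℤ.≤-trans (last w in-w) (lo≤hi v))) ⟩
      weight w * 𝟙 (lo w ℤ.≤? hi v)      ∎
    case w (no _) = *-monoʳ-≤ (weight w) (𝟙-mono (lo w ℤ.<? lo u) (lo w ℤ.≤? hi v)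
                      λ w<u → ℤ.≤-trans (ℤ.<⇒≤ w<u) (ℤ.≤-trans (first v in-v) (lo≤hi v)))

  -- Overlapping intervals satisfy `birth v ≤ death u` and `birth u ≤ death v`, so whatever meets an
  -- interval inside the window touches the window.
  window : ∀ r → # (inside? r) ≤ # (touching? r)
  window r = swap (inside? r) (touching? r) proj₁ (#inside≤ℓ r)
    λ { (_ , death≤r , r<birth) Qv u≤v v≤u →
        Qv , ≤-trans (birth≤death v≤u) death≤r , <-≤-trans r<birth (+-monoˡ-≤ ℓ (birth≤death u≤v)) }

  windows : ∑[ u < n ] (𝟙 (P? u) * (birth u + ℓ ∸ death u)) ≤ ∑[ u < n ] (𝟙 (Q? u) * (death u + ℓ ∸ birth u))
  windows = subst₂ _≤_ (*-identityˡ _) (*-identityˡ _)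
    (sum-over-windows birth death (𝟙 ∘ P?) (𝟙 ∘ Q?) ℓ 1 1 λ r →
      subst₂ _≤_ (reshape P? (λ u → inRange? (death u) (birth u + ℓ) r))
                 (reshape Q? (λ u → inRange? (birth u) (death u + ℓ) r)) (window r))
    where
    reshape : ∀ {A B : Fin n → Set} (A? : Decidable A) (B? : Decidable B) →
      # (λ u → A? u ×-dec B? u) ≡ 1 * ∑[ u < n ] (𝟙 (A? u) * 𝟙 (B? u))
    reshape A? B? = trans (sum-cong-≗ λ u → 𝟙-× (A? u) (B? u)) (sym (*-identityˡ _))

  -- Exchange the sums: a fixed `v` is charged by those `u` whose interval contains the row `lo v`,
  -- and `depth` bounds their weight by `W`. A single span has no such bound.
  total-span : ∑[ u < n ] (weight u * span u) ≤ (# P? + # Q?) * W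
  total-span = begin
    ∑[ u < n ] (weight u * span u)
      ≡⟨ ∑-*-∑ {n} weight _ ⟩
    ∑[ v < n ] ∑[ u < n ] (weight u * (weight v * 𝟙 ((lo u ℤ.≤? lo v) ×-dec (lo v ℤ.≤? hi u))))
      ≡⟨ sum-cong-≗ {n} (λ v → trans (sum-cong-≗ {n} (λ u → exchange (weight u) (weight v) _)) (sym (*-distribˡ-sum {n} (weight v) _))) ⟩
    ∑[ v < n ] (weight v * ∑[ u < n ] (weight u * 𝟙 ((lo u ℤ.≤? lo v) ×-dec (lo v ℤ.≤? hi u))))
      ≤⟨ sum-mono {n} (λ v → *-monoʳ-≤ (weight v) (depth (lo v))) ⟩
    ∑[ v < n ] (weight v * W)
      ≡⟨ *-distribʳ-sum W weight ⟨
    ∑[ v < n ] weight v * W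
      ≡⟨ cong (_* W) (∑-distrib-+ {n} _ _) ⟩
    (# P? + # Q?) * W ∎
    where
    open ≤-Reasoning
    exchange : ∀ a b c → a * (b * c) ≡ b * (a * c)
    exchange = solve-∀

  -- An interval lies in at least `ℓ - span u` windows and touches at most `ℓ + span u`. The errors
  -- are collected on the right, where `total-span` bounds their sum.
  strip-bound : ℓ * # P? ≤ ℓ * # Q? + (# P? + # Q?) * W
  strip-bound = begin
    ℓ * # P?
      ≡⟨ *-distribˡ-sum {n} ℓ _ ⟩
    ∑[ u < n ] (ℓ * 𝟙 (P? u))
      ≤⟨ sum-mono (λ u → ≤-trans (≤-reflexive (*-comm ℓ (𝟙 (P? u)))) (≤-trans (*-monoʳ-≤ (𝟙 (P? u)) (lower u)) (≤-reflexive (*-distribˡ-+ (𝟙 (P? u)) _ _)))) ⟩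
    ∑[ u < n ] (𝟙 (P? u) * (birth u + ℓ ∸ death u) + 𝟙 (P? u) * span u)
      ≡⟨ ∑-distrib-+ {n} _ _ ⟩
    ∑[ u < n ] (𝟙 (P? u) * (birth u + ℓ ∸ death u)) + ∑[ u < n ] (𝟙 (P? u) * span u)
      ≤⟨ +-monoˡ-≤ _ windows ⟩
    ∑[ u < n ] (𝟙 (Q? u) * (death u + ℓ ∸ birth u)) + ∑[ u < n ] (𝟙 (P? u) * span u)
      ≡⟨ ∑-distrib-+ {n} _ _ ⟨
    ∑[ u < n ] (𝟙 (Q? u) * (death u + ℓ ∸ birth u) + 𝟙 (P? u) * span u)
      ≤⟨ sum-mono (λ u → ≤-trans (+-monoˡ-≤ _ (*-monoʳ-≤ (𝟙 (Q? u)) (upper u))) (≤-reflexive (collect (𝟙 (Q? u)) ℓ (span u) (𝟙 (P? u))))) ⟩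
    ∑[ u < n ] (ℓ * 𝟙 (Q? u) + weight u * span u)
      ≡⟨ ∑-distrib-+ {n} _ _ ⟩
    ∑[ u < n ] (ℓ * 𝟙 (Q? u)) + ∑[ u < n ] (weight u * span u)
      ≤⟨ +-mono-≤ (≤-reflexive (sym (*-distribˡ-sum {n} ℓ _))) total-span ⟩
    ℓ * # Q? + (# P? + # Q?) * W ∎
    where
    open ≤-Reasoning
    -- For an interval that fits into no window the truncated difference is 0, but then `span u`
    -- alone reaches `ℓ`.
    lower : ∀ u → ℓ ≤ (birth u + ℓ ∸ death u) + span u
    lower u = +-cancelˡ-≤ (death u) _ _ (begin
      death u + ℓ ≤⟨ +-monoˡ-≤ ℓ (death≤birth+span u) ⟩
      birth u + span u + ℓ ≡⟨ rearrange (birth u) (span u) ℓ ⟩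
      birth u + ℓ + span u ≤⟨ +-monoˡ-≤ (span u) (m≤n+m∸n (birth u + ℓ) (death u)) ⟩
      death u + (birth u + ℓ ∸ death u) + span u ≡⟨ +-assoc (death u) _ _ ⟩
      death u + ((birth u + ℓ ∸ death u) + span u) ∎)
      where
      rearrange : ∀ a b c → a + b + c ≡ a + c + b
      rearrange = solve-∀
    upper : ∀ u → death u + ℓ ∸ birth u ≤ ℓ + span u
    upper u = m≤n+o⇒m∸n≤o (death u + ℓ) (birth u) (begin
      death u + ℓ ≤⟨ +-monoˡ-≤ ℓ (death≤birth+span u) ⟩
      birth u + span u + ℓ ≡⟨ rearrange (birth u) (span u) ℓ ⟩
      birth u + (ℓ + span u) ∎)
      where
      rearrange : ∀ a b c → a + b + c ≡ a + (c + b)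
      rearrange = solve-∀
    collect : ∀ q ℓ s p → q * (ℓ + s) + p * s ≡ ℓ * q + (p + q) * s
    collect = solve-∀

-- Boxes around the paths

neighbour : Fin 4 → Point → Point
neighbour 0F (i , j) = i ℤ.+ ℤ.1ℤ , j
neighbour 1F (i , j) = i ℤ.- ℤ.1ℤ , j
neighbour 2F (i , j) = i , j ℤ.+ ℤ.1ℤ
neighbour 3F (i , j) = i , j ℤ.- ℤ.1ℤ

gridEdge-neighbour : ∀ d p → GridEdge p (neighbour d p)
gridEdge-neighbour d (i , j) = cases d
  where
  up : ∀ i → i ℤ.- (i ℤ.+ ℤ.1ℤ) ≡ ℤ.-1ℤ
  up = ℤ-solve-∀
  down : ∀ i → i ℤ.- (i ℤ.- ℤ.1ℤ) ≡ ℤ.1ℤ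
  down = ℤ-solve-∀
  cases : ∀ d → GridEdge (i , j) (neighbour d (i , j))
  cases 0F = cong₂ _+_ (cong ℤ.∣_∣ (up i)) (cong ℤ.∣_∣ (ℤ.i≡j⇒i-j≡0 {j} refl))
  cases 1F = cong₂ _+_ (cong ℤ.∣_∣ (down i)) (cong ℤ.∣_∣ (ℤ.i≡j⇒i-j≡0 {j} refl))
  cases 2F = cong₂ _+_ (cong ℤ.∣_∣ (ℤ.i≡j⇒i-j≡0 {i} refl)) (cong ℤ.∣_∣ (up j))
  cases 3F = cong₂ _+_ (cong ℤ.∣_∣ (ℤ.i≡j⇒i-j≡0 {i} refl)) (cong ℤ.∣_∣ (down j))

gridEdge⇒neighbour : ∀ {p q} → GridEdge p q → ∃[ d ] q ≡ neighbour d p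
gridEdge⇒neighbour {i , j} {i′ , j′} e = cases (i ℤ.- i′) (j ℤ.- j′) refl refl e
  where
  same : ∀ k l → k ℤ.- l ≡ ℤ.0ℤ → l ≡ k
  same k l eq = sym (ℤ.i-j≡0⇒i≡j k l eq)
  cancel : ∀ k l → l ≡ k ℤ.- (k ℤ.- l)
  cancel = ℤ-solve-∀
  moved : ∀ k l {m} → k ℤ.- l ≡ m → l ≡ k ℤ.- m
  moved k l eq = trans (cancel k l) (cong (λ m → k ℤ.- m) eq)
  cases : ∀ a b → i ℤ.- i′ ≡ a → j ℤ.- j′ ≡ b → ℤ.∣ a ∣ + ℤ.∣ b ∣ ≡ 1 →
          ∃[ d ] (i′ , j′) ≡ neighbour d (i , j)
  cases (+ 0)       (+ 1)      a b _ = 3F , cong₂ _,_ (same i i′ a) (moved j j′ b)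
  cases (+ 0)       (-[1+ 0 ]) a b _ = 2F , cong₂ _,_ (same i i′ a) (moved j j′ b)
  cases (+ 1)       (+ 0)      a b _ = 1F , cong₂ _,_ (moved i i′ a) (same j j′ b)
  cases (-[1+ 0 ])  (+ 0)      a b _ = 0F , cong₂ _,_ (moved i i′ a) (same j j′ b)

gridEdge-sym : ∀ {p q} → GridEdge p q → GridEdge q p
gridEdge-sym {i , j} {i′ , j′} e = trans (cong₂ _+_ (ℤ.∣i-j∣≡∣j-i∣ i′ i) (ℤ.∣i-j∣≡∣j-i∣ j′ j)) e

row-step : ∀ p q → GridEdge p q → proj₂ q ℤ.≤ ℤ.suc (proj₂ p)
row-step p@(i , j) q e with gridEdge⇒neighbour {p} {q} e
... | 0F , refl = ℤ.i≤suc[i] j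
... | 1F , refl = ℤ.i≤suc[i] j
... | 2F , refl = ℤ.≤-reflexive (ℤ.+-comm j ℤ.1ℤ)
... | 3F , refl = ℤ.≤-trans (ℤ.i-j≤i j ℤ.1ℤ) (ℤ.i≤suc[i] j)

-- A height that rises by at most one per step cannot jump over `y` on its way up. Descents are
-- covered by applying this to the negated height.
intermediate-value : (h : Point → ℤ) → (∀ p q → GridEdge p q → h q ℤ.≤ ℤ.suc (h p)) →
  ∀ {p ps q y} → Linked GridEdge (p ∷ ps) → q List.∈ p ∷ ps → h p ℤ.≤ y → y ℤ.≤ h q →
  ∃[ r ] r List.∈ p ∷ ps × h r ≡ y
intermediate-value h step {p} {y = y} linked q∈ p≤y y≤q with h p ℤ.≟ y
... | yes hp≡y = p , here refl , hp≡y
intermediate-value h step _              (here refl) p≤y y≤q | no hp≢y = contradiction (ℤ.≤-antisym p≤y y≤q) hp≢y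
intermediate-value h step (e ∷ linked)   (there q∈)  p≤y y≤q | no hp≢y
  with intermediate-value h step linked q∈ (ℤ.≤-trans (step _ _ e) (ℤ.i<j⇒suc[i]≤j (ℤ.≤∧≢⇒< p≤y hp≢y))) y≤q
... | r , r∈ , hr≡y = r , there r∈ , hr≡y

module Extremum {_≼_ : Rel ℤ 0ℓ} (_∘′_ : ℤ → ℤ → ℤ) (≼-refl : ∀ i → i ≼ i) (≼-trans : Transitive _≼_)
  (lowerˡ : ∀ i j → (i ∘′ j) ≼ i) (lowerʳ : ∀ i j → (i ∘′ j) ≼ j)
  (sel : ∀ i j → (i ∘′ j) ≡ i ⊎ (i ∘′ j) ≡ j) where

  bound : ∀ x xs {z} → z List.∈ x ∷ xs → foldr₁ _∘′_ (x List⁺.∷ xs) ≼ z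
  bound x []       (here refl) = ≼-refl x
  bound x (y ∷ ys) (here refl) = lowerˡ x _
  bound x (y ∷ ys) (there z∈)  = ≼-trans (lowerʳ x _) (bound y ys z∈)

  attained : ∀ x xs → foldr₁ _∘′_ (x List⁺.∷ xs) List.∈ x ∷ xs
  attained x []       = here refl
  attained x (y ∷ ys) with sel x (foldr₁ _∘′_ (y List⁺.∷ ys))
  ... | inj₁ eq = here eq
  ... | inj₂ eq = there (subst (List._∈ y ∷ ys) (sym eq) (attained y ys))

  bound-along : ∀ (h : Point → ℤ) P {p} → p List.∈ vertices P →
    foldr₁ _∘′_ (List⁺.map h (points P)) ≼ h p
  bound-along h P p∈ = bound _ _ (∈-map⁺ h p∈)

  attained-along : ∀ (h : Point → ℤ) P →
    ∃[ p ] p List.∈ vertices P × foldr₁ _∘′_ (List⁺.map h (points P)) ≡ h p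
  attained-along h P = ∈-map⁻ h (attained (h (List⁺.head (points P))) _)

module Min = Extremum {ℤ._≤_} ℤ._⊓_ (λ _ → ℤ.≤-refl) ℤ.≤-trans ℤ.i⊓j≤i ℤ.i⊓j≤j ℤ.⊓-sel
module Max = Extremum {flip ℤ._≤_} ℤ._⊔_ (λ _ → ℤ.≤-refl) (flip ℤ.≤-trans) ℤ.i≤i⊔j ℤ.i≤j⊔i ℤ.⊔-sel

ymin ymax : GridPath → ℤ
ymin P = foldr₁ ℤ._⊓_ (List⁺.map proj₂ (points P))
ymax P = foldr₁ ℤ._⊔_ (List⁺.map proj₂ (points P))

-- This makes the row interval of a box honest: a box containing the row yields an actual point of
-- the path there, hence a loaded grid-edge.
crosses-row : ∀ P {y} → ymin P ℤ.≤ y → y ℤ.≤ ymax P → ∃[ p ] p List.∈ vertices P × proj₂ p ≡ y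
crosses-row P {y} ymin≤y y≤ymax with ℤ.≤-total (proj₂ (List⁺.head (points P))) y
... | inj₁ head≤y with Max.attained-along proj₂ P
...   | q , q∈ , eq = intermediate-value proj₂ row-step (joined P) q∈ head≤y (ℤ.≤-trans y≤ymax (ℤ.≤-reflexive eq))
crosses-row P {y} ymin≤y y≤ymax | inj₂ y≤head with Min.attained-along proj₂ P
...   | q , q∈ , eq
  with intermediate-value (λ p → ℤ.- proj₂ p) (λ p q e → neg-step (row-step q p (gridEdge-sym {p} {q} e))) (joined P) q∈
         (ℤ.neg-mono-≤ y≤head) (ℤ.neg-mono-≤ (ℤ.≤-trans (ℤ.≤-reflexive (sym eq)) ymin≤y))
  where
  neg-step : ∀ {i j} → i ℤ.≤ ℤ.suc j → ℤ.- j ℤ.≤ ℤ.suc (ℤ.- i)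
  neg-step {i} {j} i≤ = subst (ℤ._≤ ℤ.suc (ℤ.- i)) (lemma j) (ℤ.suc-mono (ℤ.neg-mono-≤ i≤))
    where
    lemma : ∀ j → ℤ.1ℤ ℤ.+ (ℤ.- (ℤ.1ℤ ℤ.+ j)) ≡ ℤ.- j
    lemma = ℤ-solve-∀
... | r , r∈ , -r≡-y = r , r∈ , ℤ.neg-injective -r≡-y

uses-some-edge : ∀ {x y ps p} → Linked GridEdge (x ∷ y ∷ ps) → p List.∈ x ∷ y ∷ ps →
  let edgeList = zip (x ∷ y ∷ ps) (y ∷ ps) in
  ∃[ q ] GridEdge p q × ((p , q) List.∈ edgeList ⊎ (q , p) List.∈ edgeList)
uses-some-edge {x} {y} (e ∷ _) (here refl)         = y , e , inj₁ (here refl)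
uses-some-edge {x} {y} (e ∷ _) (there (here refl)) = x , gridEdge-sym {x} {y} e , inj₂ (here refl)
uses-some-edge {ps = _ ∷ _} (_ ∷ linked) (there (there p∈)) with uses-some-edge linked (there p∈)
... | q , e , uses = q , e , Sum.map there there uses

-- A path has at least one edge, so each of its points is an end of an edge that it uses. Thus a
-- load of `t` per edge allows at most `4 * t` paths through a point.
uses-neighbour : ∀ P {p} → p List.∈ vertices P → ∃[ d ] Uses p (neighbour d p) P
uses-neighbour record { points = x List⁺.∷ y ∷ ps ; joined = linked } {p} p∈ with uses-some-edge linked p∈
... | q , e , uses with gridEdge⇒neighbour {p} {q} e
...   | d , refl = d , uses
uses-neighbour record { points = x List⁺.∷ [] ; nonempty = s≤s () } p∈

length-filter-tabulate : ∀ {A : Set} {Q : A → Set} (Q? : Decidable Q) (f : Fin n → A) →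
  length (filter Q? (tabulate f)) ≡ # (Q? ∘ f)
length-filter-tabulate {zero}  Q? f = refl
length-filter-tabulate {suc n} Q? f with does (Q? (f 0F))
... | true  = cong suc (length-filter-tabulate Q? (f ∘ Fin.suc))
... | false = length-filter-tabulate Q? (f ∘ Fin.suc)

module Boxes {n} {G : Graph n} (R : VPGRepresentation G) where
  open VPGRepresentation R

  -- A common shift that makes all columns of the paths non-negative, so that strips can be indexed
  -- by `ℕ`. Rows stay in `ℤ`, as the sweep uses only their order.
  offset : ℕ
  offset = ∑[ u < n ] ℤ.∣ xmin (path u) ∣

  xl xr : Fin n → ℕ
  xl u = ℤ.∣ xmin (path u) ℤ.+ + offset ∣
  xr u = ℤ.∣ xmax (path u) ℤ.+ + offset ∣

  yl yr : Fin n → ℤ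
  yl u = ymin (path u)
  yr u = ymax (path u)

  xmin≤xmax : ∀ u → xmin (path u) ℤ.≤ xmax (path u)
  xmin≤xmax u = ℤ.≤-trans (Min.bound-along proj₁ (path u) (here refl)) (Max.bound-along proj₁ (path u) (here refl))

  yl≤yr : ∀ u → yl u ℤ.≤ yr u
  yl≤yr u = ℤ.≤-trans (Min.bound-along proj₂ (path u) (here refl)) (Max.bound-along proj₂ (path u) (here refl))

  +∣∣-cancel : ∀ i j → ℤ.∣ i ∣ ≤ j → ℤ.0ℤ ℤ.≤ i ℤ.+ + j
  +∣∣-cancel (+ i)      j _   = ℤ.+≤+ z≤n
  +∣∣-cancel (-[1+ i ]) j i≤j = subst (ℤ.0ℤ ℤ.≤_) (sym (ℤ.⊖-≥ i≤j)) (ℤ.+≤+ z≤n)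

  0≤xmin+offset : ∀ u → ℤ.0ℤ ℤ.≤ xmin (path u) ℤ.+ + offset
  0≤xmin+offset u = +∣∣-cancel (xmin (path u)) offset (term≤sum (λ u → ℤ.∣ xmin (path u) ∣) u)

  +xl : ∀ u → + xl u ≡ xmin (path u) ℤ.+ + offset
  +xl u = ℤ.0≤i⇒+∣i∣≡i (0≤xmin+offset u)

  +xr : ∀ u → + xr u ≡ xmax (path u) ℤ.+ + offset
  +xr u = ℤ.0≤i⇒+∣i∣≡i (ℤ.≤-trans (0≤xmin+offset u) (ℤ.+-monoˡ-≤ (+ offset) (xmin≤xmax u)))

  xl≤xr : ∀ u → xl u ≤ xr u
  xl≤xr u = ℤ.drop‿+≤+ (subst₂ ℤ._≤_ (sym (+xl u)) (sym (+xr u)) (ℤ.+-monoˡ-≤ (+ offset) (xmin≤xmax u)))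

  xr≤xl+ : ∀ {c u} → xmax (path u) ℤ.- xmin (path u) ℤ.≤ + c → xr u ≤ xl u + c
  xr≤xl+ {c} {u} w≤c = ℤ.drop‿+≤+ (begin
    + xr u                          ≡⟨ +xr u ⟩
    xmax (path u) ℤ.+ + offset      ≡⟨ lemma (xmax (path u)) (xmin (path u)) (+ offset) ⟩
    (xmin (path u) ℤ.+ + offset) ℤ.+ (xmax (path u) ℤ.- xmin (path u))
                                    ≤⟨ ℤ.+-monoʳ-≤ (xmin (path u) ℤ.+ + offset) w≤c ⟩
    (xmin (path u) ℤ.+ + offset) ℤ.+ + c ≡⟨ cong (ℤ._+ + c) (+xl u) ⟨
    + xl u ℤ.+ + c                  ∎)
    where
    open ℤ.≤-Reasoning
    lemma : ∀ a b d → a ℤ.+ d ≡ (b ℤ.+ d) ℤ.+ (a ℤ.- b)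
    lemma = ℤ-solve-∀

  module _ {u v} (u≢v : u ≢ v) (uv : Graph.Adj G u v) where

    common : path u Meets path v
    common = Equivalence.to (represents u v u≢v) uv

    adj⇒yl≤yr : yl u ℤ.≤ yr v
    adj⇒yl≤yr with common
    ... | p , p∈u , p∈v = ℤ.≤-trans (Min.bound-along proj₂ (path u) p∈u) (Max.bound-along proj₂ (path v) p∈v)

    adj⇒xl≤xr : xl u ≤ xr v
    adj⇒xl≤xr with common
    ... | p , p∈u , p∈v = ℤ.drop‿+≤+ (subst₂ ℤ._≤_ (sym (+xl u)) (sym (+xr v)) (ℤ.+-monoˡ-≤ (+ offset)
      (ℤ.≤-trans (Min.bound-along proj₁ (path u) p∈u) (Max.bound-along proj₁ (path v) p∈v))))

  module _ {t c : ℕ}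
    (load≤ : ∀ p q → GridEdge p q → length (filter (λ u → uses? p q (path u)) (allFin n)) ≤ t)
    (length≤ : ∀ u → xmax (path u) ℤ.- xmin (path u) ℤ.≤ + c)
    (ℓ r : ℕ) (y : ℤ) where

    Crossing : Fin n → Set
    Crossing u = (xl u ≤ r × r < xr u + ℓ) × (yl u ℤ.≤ y × y ℤ.≤ yr u)

    crossing? : Decidable Crossing
    crossing? u = inRange? (xl u) (xr u + ℓ) r ×-dec ((yl u ℤ.≤? y) ×-dec (y ℤ.≤? yr u))

    width : ℕ
    width = c + ℓ + c

    -- For i < width, the points of row y at distance at most c from the window
    -- (r − ℓ , r], in the original coordinates.
    site : ℕ → Point
    site i = + i ℤ.+ + suc r ℤ.- + (c + ℓ) ℤ.- + offset , y

    crossing⇒site : ∀ {u} → Crossing u → ∃[ i ] i < width × site i List.∈ vertices (path u)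
    crossing⇒site {u} ((xl≤r , r<xr+ℓ) , yl≤y , y≤yr) with crosses-row (path u) yl≤y y≤yr
    ... | (x , _) , p∈ , refl = i , i<width , subst (λ k → (k , y) List.∈ vertices (path u)) x≡ p∈
      where
      X = ℤ.∣ x ℤ.+ + offset ∣

      xmin≤x : xmin (path u) ℤ.≤ x
      xmin≤x = Min.bound-along proj₁ (path u) p∈

      +X : + X ≡ x ℤ.+ + offset
      +X = ℤ.0≤i⇒+∣i∣≡i (ℤ.≤-trans (0≤xmin+offset u) (ℤ.+-monoˡ-≤ (+ offset) xmin≤x))

      xl≤X : xl u ≤ X
      xl≤X = ℤ.drop‿+≤+ (subst₂ ℤ._≤_ (sym (+xl u)) (sym +X) (ℤ.+-monoˡ-≤ (+ offset) xmin≤x))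

      X≤xr : X ≤ xr u
      X≤xr = ℤ.drop‿+≤+ (subst₂ ℤ._≤_ (sym +X) (sym (+xr u))
               (ℤ.+-monoˡ-≤ (+ offset) (Max.bound-along proj₁ (path u) p∈)))

      -- The position of the point counted from the leftmost column `suc r - (c + ℓ)` that a path
      -- touching the strip can reach; `i+` shows that nothing is truncated.
      i = X + (c + ℓ) ∸ suc r

      i+ : i + suc r ≡ X + (c + ℓ)
      i+ = m∸n+n≡m (begin
        suc r          ≤⟨ r<xr+ℓ ⟩
        xr u + ℓ       ≤⟨ +-monoˡ-≤ ℓ (≤-trans (xr≤xl+ {u = u} (length≤ u)) (+-monoˡ-≤ c xl≤X)) ⟩
        X + c + ℓ      ≡⟨ +-assoc X c ℓ ⟩
        X + (c + ℓ)    ∎)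
        where open ≤-Reasoning

      i<width : i < width
      i<width = +-cancelʳ-≤ r _ _ (begin
        suc i + r        ≡⟨ +-suc i r ⟨
        i + suc r        ≡⟨ i+ ⟩
        X + (c + ℓ)
          ≤⟨ +-monoˡ-≤ (c + ℓ) (≤-trans X≤xr (≤-trans (xr≤xl+ {u = u} (length≤ u)) (+-monoˡ-≤ c xl≤r))) ⟩
        r + c + (c + ℓ)  ≡⟨ +-assoc r c (c + ℓ) ⟩
        r + (c + (c + ℓ)) ≡⟨ +-comm r _ ⟩
        c + (c + ℓ) + r  ≡⟨ cong (_+ r) (+-comm c (c + ℓ)) ⟩
        width + r        ∎)
        where open ≤-Reasoning

      x≡ : x ≡ + i ℤ.+ + suc r ℤ.- + (c + ℓ) ℤ.- + offset
      x≡ = begin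
        x                                                      ≡⟨ lemma x (+ offset) (+ (c + ℓ)) ⟩
        (x ℤ.+ + offset) ℤ.+ + (c + ℓ) ℤ.- + (c + ℓ) ℤ.- + offset
          ≡⟨ cong (λ k → k ℤ.+ + (c + ℓ) ℤ.- + (c + ℓ) ℤ.- + offset) +X ⟨
        + (X + (c + ℓ)) ℤ.- + (c + ℓ) ℤ.- + offset             ≡⟨ cong (λ k → + k ℤ.- + (c + ℓ) ℤ.- + offset) i+ ⟨
        + (i + suc r) ℤ.- + (c + ℓ) ℤ.- + offset               ∎
        where
        open ≡-Reasoning
        lemma : ∀ a b d → a ≡ (a ℤ.+ b) ℤ.+ d ℤ.- d ℤ.- b
        lemma = ℤ-solve-∀

    siteUse : Fin width → Fin 4 → Fin n → ℕ
    siteUse i d u = 𝟙 (uses? (site (toℕ i)) (neighbour d (site (toℕ i))) (path u))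

    crossing≤siteUses : ∀ u → 𝟙 (crossing? u) ≤ ∑[ i < width ] ∑[ d < 4 ] siteUse i d u
    crossing≤siteUses u = 𝟙-≤ (crossing? u) found-site
      where
      found-site : Crossing u → 1 ≤ ∑[ i < width ] ∑[ d < 4 ] siteUse i d u
      found-site cross with crossing⇒site {u} cross
      ... | i , i<w , site∈ with uses-neighbour (path u) site∈
      ...   | d , uses = ≤-trans (≤-trans
        (1≤𝟙 (uses? _ _ (path u)) (subst (λ j → Uses (site j) (neighbour d (site j)) (path u)) (sym (toℕ-fromℕ< i<w)) uses))
        (term≤sum (λ d → siteUse (fromℕ< i<w) d u) d))
        (term≤sum (λ i → ∑[ d < 4 ] siteUse i d u) (fromℕ< i<w))

    -- Every crossing path uses one of the 4 edges at one of `width` points of the row, and each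
    -- edge carries at most `t` paths.
    #crossing≤ : # crossing? ≤ width * (4 * t)
    #crossing≤ = begin
      # crossing?                                               ≤⟨ sum-mono crossing≤siteUses ⟩
      ∑[ u < n ] ∑[ i < width ] ∑[ d < 4 ] siteUse i d u        ≡⟨ ∑-comm {n} {width} _ ⟩
      ∑[ i < width ] ∑[ u < n ] ∑[ d < 4 ] siteUse i d u
        ≡⟨ sum-cong-≗ {width} (λ i → ∑-comm {n} {4} (λ u d → siteUse i d u)) ⟩
      ∑[ i < width ] ∑[ d < 4 ] ∑[ u < n ] siteUse i d u
        ≤⟨ sum-mono {width} (λ i → sum-mono {4} (λ d → site-load (toℕ i) d)) ⟩
      ∑[ i < width ] ∑[ d < 4 ] t
        ≡⟨ trans (sum-cong-≗ {width} (λ _ → sum-const 4 t)) (sum-const width (4 * t)) ⟩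
      width * (4 * t)                                           ∎
      where
      open ≤-Reasoning
      site-load : ∀ i d → # (λ u → uses? (site i) (neighbour d (site i)) (path u)) ≤ t
      site-load i d = ≤-trans
        (≤-reflexive (sym (length-filter-tabulate (λ u → uses? (site i) (neighbour d (site i)) (path u)) (λ u → u))))
        (load≤ (site i) (neighbour d (site i)) (gridEdge-neighbour d (site i)))

-- Polynomial bounds

_+ₚ_ _*ₚ_ : Polynomial → Polynomial → Polynomial
[]      +ₚ q       = q
(a ∷ p) +ₚ []      = a ∷ p
(a ∷ p) +ₚ (b ∷ q) = a + b ∷ p +ₚ q

[]      *ₚ q = []
(a ∷ p) *ₚ q = List.map (a *_) q +ₚ (0 ∷ p *ₚ q)

eval-+ₚ : ∀ p q x → eval (p +ₚ q) x ≡ eval p x + eval q x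
eval-+ₚ []      q       x = refl
eval-+ₚ (a ∷ p) []      x = sym (+-identityʳ _)
eval-+ₚ (a ∷ p) (b ∷ q) x = trans (cong (λ e → a + b + x * e) (eval-+ₚ p q x))
  (shuffle a b x (eval p x) (eval q x))
  where
  shuffle : ∀ a b x e f → a + b + x * (e + f) ≡ a + x * e + (b + x * f)
  shuffle = solve-∀

eval-scale : ∀ a q x → eval (List.map (a *_) q) x ≡ a * eval q x
eval-scale a []      x = sym (*-zeroʳ a)
eval-scale a (b ∷ q) x = trans (cong (λ e → a * b + x * e) (eval-scale a q x))
  (factor a b x (eval q x))
  where
  factor : ∀ a b x e → a * b + x * (a * e) ≡ a * (b + x * e)
  factor = solve-∀

eval-*ₚ : ∀ p q x → eval (p *ₚ q) x ≡ eval p x * eval q x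
eval-*ₚ []      q x = refl
eval-*ₚ (a ∷ p) q x = begin
  eval (List.map (a *_) q +ₚ (0 ∷ p *ₚ q)) x    ≡⟨ eval-+ₚ (List.map (a *_) q) _ x ⟩
  eval (List.map (a *_) q) x + x * eval (p *ₚ q) x ≡⟨ cong₂ (λ e f → e + x * f) (eval-scale a q x) (eval-*ₚ p q x) ⟩
  a * eval q x + x * (eval p x * eval q x)      ≡⟨ factor a x (eval p x) (eval q x) ⟩
  (a + x * eval p x) * eval q x                 ∎
  where
  open ≡-Reasoning
  factor : ∀ a x e f → a * f + x * (e * f) ≡ (a + x * e) * f
  factor = solve-∀

eval-mono : ∀ p {x y} → x ≤ y → eval p x ≤ eval p y
eval-mono []      x≤y = z≤n
eval-mono (a ∷ p) x≤y = +-monoʳ-≤ a (*-mono-≤ x≤y (eval-mono p x≤y))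

PolyBounded : (ℕ → ℕ) → Set
PolyBounded f = ∃[ p ] ∀ x → f x ≤ eval p x

constₚ : ∀ a → PolyBounded (λ _ → a)
constₚ a = a ∷ [] , λ x → m≤m+n a _

idₚ : PolyBounded id
idₚ = 0 ∷ 1 ∷ [] , λ x → ≤-reflexive (expand-X x)
  where
  expand-X : ∀ x → x ≡ x * (1 + x * 0)
  expand-X = solve-∀

infixl 6 _⊕_
infixl 7 _⊗_

_⊕_ : ∀ {f g} → PolyBounded f → PolyBounded g → PolyBounded (λ x → f x + g x)
(p , f≤) ⊕ (q , g≤) = p +ₚ q , λ x →
  ≤-trans (+-mono-≤ (f≤ x) (g≤ x)) (≤-reflexive (sym (eval-+ₚ p q x)))

_⊗_ : ∀ {f g} → PolyBounded f → PolyBounded g → PolyBounded (λ x → f x * g x)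
(p , f≤) ⊗ (q , g≤) = p *ₚ q , λ x →
  ≤-trans (*-mono-≤ (f≤ x) (g≤ x)) (≤-reflexive (sym (eval-*ₚ p q x)))

loopTimeₚ : ∀ {f g} → PolyBounded f → PolyBounded g → PolyBounded (λ x → loopTime (f x) (g x))
loopTimeₚ f g = f ⊗ (constₚ 2 ⊕ g) ⊕ constₚ 2

tryAllTimeₚ : PolyBounded tryAllTime
tryAllTimeₚ = constₚ 8 ⊕ (loopTimeₚ idₚ (constₚ 8 ⊕ (insertTimeₚ ⊕ constₚ 13)) ⊕ constₚ 5)
  where
  insertTimeₚ : PolyBounded insertTime
  insertTimeₚ = loopTimeₚ idₚ (constₚ 60) ⊕ (loopTimeₚ idₚ (constₚ 8) ⊕ constₚ 2)

betterTimeₚ : PolyBounded betterTime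
betterTimeₚ = constₚ 3 ⊕ (loopTimeₚ idₚ (constₚ 20) ⊕ (constₚ 2 ⊕ (loopTimeₚ idₚ (constₚ 20) ⊕ constₚ 12)))

poolSizeₚ : ∀ d → PolyBounded (λ n → poolSize n d)
poolSizeₚ zero    = constₚ 1
poolSizeₚ (suc d) = poolSizeₚ d ⊗ (constₚ 1 ⊕ idₚ)

exploreTimeₚ : ∀ d → PolyBounded (λ n → exploreTime n d)
exploreTimeₚ zero    = constₚ 4
exploreTimeₚ (suc d) = exploreTimeₚ d ⊕ (constₚ 2 ⊕ (loopTimeₚ (poolSizeₚ d) tryAllTimeₚ ⊕ constₚ 4))

localSearchTimeₚ : ∀ d → PolyBounded (λ n → localSearchTime n d)
localSearchTimeₚ d = constₚ 7 ⊕ (loopTimeₚ idₚ (constₚ 8) ⊕ (constₚ 2 ⊕ loopTimeₚ idₚ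
  (exploreTimeₚ d ⊕ (loopTimeₚ (poolSizeₚ d) betterTimeₚ ⊕ constₚ 3))))

-- The approximation ratio of local optima

∣_∣≡# : ∀ (s : Subset n) → ∣ s ∣ ≡ # (_∈? s)
∣ [] ∣≡#          = refl
∣ outside ∷ s ∣≡# = ∣ s ∣≡#
∣ inside ∷ s ∣≡#  = cong suc ∣ s ∣≡#

-- A vertex counts twice if it lies in both sets; the successor allows the
-- weight to be cancelled when t = 0.
maxWeight swapSize : ℕ → ℕ → ℕ → ℕ
maxWeight t c z = suc (uses + uses)
  where uses = (c + c * suc z + c) * (4 * t)
swapSize t c z = maxWeight t c z * suc z

module Ratio {n} {𝔾 : Graph n} (R : VPGRepresentation 𝔾) {t c : ℕ}
  (load≤ : ∀ p q → GridEdge p q →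
    length (filter (λ u → uses? p q (VPGRepresentation.path R u)) (allFin n)) ≤ t)
  (length≤ : ∀ u → xmax (VPGRepresentation.path R u) ℤ.- xmin (VPGRepresentation.path R u) ℤ.≤ + c)
  (z : ℕ) where

  open Graph 𝔾
  open Boxes R

  ℓ W ρ : ℕ
  ℓ = c * suc z
  W = maxWeight t c z
  ρ = swapSize t c z

  module _ {S O : Subset n} (O-independent : Independent 𝔾 O)
    (swaps : ∀ vs → length vs ≤ ρ → ∣ foldr (swapIn 𝔾) S vs ∣ ≤ ∣ S ∣) where

    -- Compare `S` with the set `S′` reached by swapping in `A`, vertex by vertex: `A` enters `S′`
    -- completely, and a vertex of `S` that is lost has a neighbour in `A`, so it lies in `B`. A
    -- vertex of both `A` and `S` counts twice on the left, which is why `B` must contain it too.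
    exchange : ∀ {A B : Fin n → Set} (A? : Decidable A) (B? : Decidable B) →
      (∀ {u} → A u → u ∈ O) → # A? ≤ ρ →
      (∀ {u v} → A u → v ∈ S → u ≡ v ⊎ Adj u v → B v) → # A? ≤ # B?
    exchange {A} {B} A? B? A⊆O #A≤ρ N[A]⊆B = +-cancelʳ-≤ ∣ S ∣ _ _ (begin
      # A? + ∣ S ∣            ≡⟨ cong (_+_ (# A?)) ∣ S ∣≡# ⟩
      # A? + # (_∈? S)        ≡⟨ ∑-distrib-+ {n} _ _ ⟨
      ∑[ u < n ] (𝟙 (A? u) + 𝟙 (u ∈? S))   ≤⟨ sum-mono (λ u → pointwise u (A? u)) ⟩
      ∑[ u < n ] (𝟙 (B? u) + 𝟙 (u ∈? S′))  ≡⟨ ∑-distrib-+ {n} _ _ ⟩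
      # B? + # (_∈? S′)       ≡⟨ cong (_+_ (# B?)) ∣ S′ ∣≡# ⟨
      # B? + ∣ S′ ∣
        ≤⟨ +-monoʳ-≤ (# B?) (swaps vs (≤-trans (≤-reflexive (length-filter-tabulate A? id)) #A≤ρ)) ⟩
      # B? + ∣ S ∣            ∎)
      where
      open ≤-Reasoning
      vs = filter A? (allFin n)
      S′ = foldr (swapIn 𝔾) S vs

      A-vs : ∀ {v} → v List.∈ vs → A v
      A-vs v∈ = proj₂ (∈-filter⁻ A? {xs = allFin n} v∈)

      pointwise : ∀ u (a? : Dec (A u)) → 𝟙 a? + 𝟙 (u ∈? S) ≤ 𝟙 (B? u) + 𝟙 (u ∈? S′)
      pointwise u (yes Au) = ≤-trans (≤-reflexive (+-comm 1 _)) (+-mono-≤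
        (𝟙-mono (u ∈? S) (B? u) λ u∈S → N[A]⊆B Au u∈S (inj₁ refl))
        (1≤𝟙 (u ∈? S′) (∈-swaps 𝔾 vs (inj₂ (∈-filter⁺ A? (∈-allFin u) Au))
          λ v∈ vu → O-independent _ (A⊆O (A-vs v∈)) u (A⊆O Au) vu)))
      pointwise u (no _) = 𝟙-≤ (u ∈? S) stays-or-touched
        where
        stays-or-touched : u ∈ S → 1 ≤ 𝟙 (B? u) + 𝟙 (u ∈? S′)
        stays-or-touched u∈S with any? (λ v → T? (adj v u)) vs
        ... | no none = ≤-trans (1≤𝟙 (u ∈? S′) (∈-swaps 𝔾 vs (inj₁ u∈S)
                          λ v∈ vu → none (Any.map (λ { refl → vu }) v∈))) (m≤n+m _ _)
        ... | yes some with find some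
        ...   | v , v∈ , vu = ≤-trans (1≤𝟙 (B? u) (N[A]⊆B (A-vs v∈) u∈S (inj₂ vu))) (m≤m+n _ _)

    neighbours-meet : ∀ {u v} → u ≡ v ⊎ Adj u v →
      (xl u ≤ xr v × xl v ≤ xr u) × (yl u ℤ.≤ yr v × yl v ℤ.≤ yr u)
    neighbours-meet {u} (inj₁ refl) = (xl≤xr u , xl≤xr u) , (yl≤yr u , yl≤yr u)
    neighbours-meet {u} {v} (inj₂ uv) =
      (adj⇒xl≤xr u≢v uv , adj⇒xl≤xr v≢u vu) , (adj⇒yl≤yr u≢v uv , adj⇒yl≤yr v≢u vu)
      where
      u≢v : u ≢ v
      u≢v refl = subst T (no-loop u) uv
      v≢u : v ≢ u
      v≢u = u≢v ∘ sym
      vu : Adj v u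
      vu = subst T (adj-sym u v) uv

    module _ (r : ℕ) where

      Inner Outer : Fin n → Set
      Inner u = u ∈ O × xr u ≤ r × r < xl u + ℓ
      Outer u = u ∈ S × xl u ≤ r × r < xr u + ℓ

      inner? : Decidable Inner
      inner? u = (u ∈? O) ×-dec inRange? (xr u) (xl u + ℓ) r

      outer? : Decidable Outer
      outer? u = (u ∈? S) ×-dec inRange? (xl u) (xr u + ℓ) r

      depth : ∀ y → ∑[ u < n ] ((𝟙 (inner? u) + 𝟙 (outer? u)) * 𝟙 ((yl u ℤ.≤? y) ×-dec (y ℤ.≤? yr u))) ≤ W
      depth y = begin
        ∑[ u < n ] ((𝟙 (inner? u) + 𝟙 (outer? u)) * 𝟙 ((yl u ℤ.≤? y) ×-dec (y ℤ.≤? yr u)))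
          ≤⟨ sum-mono (λ u → ≤-trans (*-monoˡ-≤ _ (+-mono-≤ (𝟙-mono (inner? u) (window? u) (inner⇒ u)) (𝟙-mono (outer? u) (window? u) proj₂))) (≤-reflexive (double u))) ⟩
        ∑[ u < n ] (𝟙 (cross? u) + 𝟙 (cross? u))
          ≡⟨ ∑-distrib-+ {n} _ _ ⟩
        # cross? + # cross?
          ≤⟨ +-mono-≤ (#crossing≤ load≤ length≤ ℓ r y) (#crossing≤ load≤ length≤ ℓ r y) ⟩
        (c + ℓ + c) * (4 * t) + (c + ℓ + c) * (4 * t)
          ≤⟨ n≤1+n _ ⟩
        W ∎
        where
        open ≤-Reasoning
        cross? = crossing? load≤ length≤ ℓ r y

        window? : Decidable (λ u → xl u ≤ r × r < xr u + ℓ)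
        window? u = inRange? (xl u) (xr u + ℓ) r

        inner⇒ : ∀ u → Inner u → xl u ≤ r × r < xr u + ℓ
        inner⇒ u (_ , xr≤r , r<) = ≤-trans (xl≤xr u) xr≤r , <-≤-trans r< (+-monoˡ-≤ ℓ (xl≤xr u))

        double : ∀ u → (𝟙 (window? u) + 𝟙 (window? u)) * 𝟙 ((yl u ℤ.≤? y) ×-dec (y ℤ.≤? yr u))
                       ≡ 𝟙 (cross? u) + 𝟙 (cross? u)
        double u = trans (*-distribʳ-+ (𝟙 ((yl u ℤ.≤? y) ×-dec (y ℤ.≤? yr u))) (𝟙 (window? u)) _)
          (sym (cong (λ k → k + k) (𝟙-× (window? u) ((yl u ℤ.≤? y) ×-dec (y ℤ.≤? yr u)))))

      -- A neighbour of a path inside the strip shares a column with it and so touches the strip.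
      -- After this only the row intervals matter, as `Strip` requires.
      exchange-inner : ∀ {A B : Fin n → Set} (A? : Decidable A) (B? : Decidable B) →
        (∀ {u} → A u → Inner u) → # A? ≤ ρ →
        (∀ {u v} → A u → Outer v → yl u ℤ.≤ yr v → yl v ℤ.≤ yr u → B v) → # A? ≤ # B?
      exchange-inner {A} {B} A? B? A⊆ #A≤ρ touch = exchange A? B? (proj₁ ∘ A⊆) #A≤ρ touched
        where
        touched : ∀ {u v} → A u → v ∈ S → u ≡ v ⊎ Adj u v → B v
        touched Au v∈S near with neighbours-meet near | A⊆ Au
        ... | (xuv , xvu) , (yuv , yvu) | _ , xr≤r , r< =
          touch Au (v∈S , ≤-trans xvu xr≤r , <-≤-trans r< (+-monoˡ-≤ ℓ xuv)) yuv yvu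

      module Slab = Strip inner? outer? yl yr yl≤yr ρ W depth exchange-inner

      -- Since `ρ = W * (z + 1)`, the factor `W` can be cancelled from `strip-bound`, followed by
      -- one copy of `# inner?` on each side.
      slab-bound : z * # inner? ≤ (2 + z) * # outer?
      slab-bound = +-cancelˡ-≤ (# inner?) _ _ (*-cancelˡ-≤ W (begin
        W * (# inner? + z * # inner?)                           ≡⟨ *-assoc W (suc z) _ ⟨
        ρ * # inner?                                            ≤⟨ Slab.strip-bound ⟩
        ρ * # outer? + (# inner? + # outer?) * W                ≡⟨ lemma W z (# inner?) (# outer?) ⟩
        W * (# inner? + (2 + z) * # outer?)                     ∎))
        where
        open ≤-Reasoning
        lemma : ∀ W z p q → W * (1 + z) * q + (p + q) * W ≡ W * (p + (2 + z) * q)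
        lemma = solve-∀

    -- The window count again, now over columns. Boxes are at most `c` wide, so here the error holds
    -- for each path separately: `ℓ - c` is `c * z` and `ℓ + c` is `c * (2 + z)`.
    ratio : c * (z * z * ∣ O ∣) ≤ c * ((2 + z) * (2 + z) * ∣ S ∣)
    ratio = begin
      c * (z * z * ∣ O ∣)                                       ≡⟨ lemma₁ c z ∣ O ∣ ⟩
      z * (∣ O ∣ * (c * z))                                     ≡⟨ cong (λ o → z * (o * (c * z))) ∣ O ∣≡# ⟩
      z * (# (_∈? O) * (c * z))                                 ≡⟨ cong (z *_) (*-distribʳ-sum {n} (c * z) _) ⟩
      z * ∑[ u < n ] (𝟙 (u ∈? O) * (c * z))
        ≤⟨ *-monoʳ-≤ z (sum-mono λ u → *-monoʳ-≤ (𝟙 (u ∈? O)) (lower u)) ⟩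
      z * ∑[ u < n ] (𝟙 (u ∈? O) * (xl u + ℓ ∸ xr u))
        ≤⟨ sum-over-windows xl xr (λ u → 𝟙 (u ∈? O)) (λ u → 𝟙 (u ∈? S)) ℓ z (2 + z)
             (λ r → subst₂ _≤_
               (cong (z *_) (sum-cong-≗ λ u → 𝟙-× (u ∈? O) (inRange? (xr u) (xl u + ℓ) r)))
               (cong ((2 + z) *_) (sum-cong-≗ λ u → 𝟙-× (u ∈? S) (inRange? (xl u) (xr u + ℓ) r)))
               (slab-bound r)) ⟩
      (2 + z) * ∑[ u < n ] (𝟙 (u ∈? S) * (xr u + ℓ ∸ xl u))
        ≤⟨ *-monoʳ-≤ (2 + z) (sum-mono λ u → *-monoʳ-≤ (𝟙 (u ∈? S)) (upper u)) ⟩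
      (2 + z) * ∑[ u < n ] (𝟙 (u ∈? S) * (c * (2 + z)))
        ≡⟨ cong ((2 + z) *_) (*-distribʳ-sum {n} (c * (2 + z)) _) ⟨
      (2 + z) * (# (_∈? S) * (c * (2 + z)))
        ≡⟨ cong (λ s → (2 + z) * (s * (c * (2 + z)))) ∣ S ∣≡# ⟨
      (2 + z) * (∣ S ∣ * (c * (2 + z)))                         ≡⟨ lemma₁ c (2 + z) ∣ S ∣ ⟨
      c * ((2 + z) * (2 + z) * ∣ S ∣)                           ∎
      where
      open ≤-Reasoning
      lemma₁ : ∀ c z o → c * (z * z * o) ≡ z * (o * (c * z))
      lemma₁ = solve-∀

      lemma₂ : ∀ x c z → x + c + c * z ≡ x + c * (1 + z)
      lemma₂ = solve-∀

      lemma₃ : ∀ x c z → x + c + c * (1 + z) ≡ x + c * (2 + z)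
      lemma₃ = solve-∀

      lower : ∀ u → c * z ≤ xl u + ℓ ∸ xr u
      lower u = m+n≤o⇒m≤o∸n (c * z) (begin
        c * z + xr u      ≡⟨ +-comm (c * z) (xr u) ⟩
        xr u + c * z      ≤⟨ +-monoˡ-≤ (c * z) (xr≤xl+ {u = u} (length≤ u)) ⟩
        xl u + c + c * z  ≡⟨ lemma₂ (xl u) c z ⟩
        xl u + ℓ          ∎)

      upper : ∀ u → xr u + ℓ ∸ xl u ≤ c * (2 + z)
      upper u = m≤n+o⇒m∸n≤o (xr u + ℓ) (xl u) (begin
        xr u + ℓ           ≤⟨ +-monoˡ-≤ ℓ (xr≤xl+ {u = u} (length≤ u)) ⟩
        xl u + c + ℓ       ≡⟨ lemma₃ (xl u) c z ⟩
        xl u + c * (2 + z) ∎)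

-- With q = m + 1 the denominator of ε and z = 4 q − 1, (z / (z + 2))² ≥ 1 − 1 / q.
ratio-of-scale : ∀ m z o s → z ≡ 3 + 4 * m → z * z * o ≤ (2 + z) * (2 + z) * s → m * o ≤ suc m * s
ratio-of-scale m _ o s refl bound = *-cancelˡ-≤ ((5 + 4 * m) * (5 + 4 * m)) (begin
  (5 + 4 * m) * (5 + 4 * m) * (m * o)           ≤⟨ m≤m+n _ ((9 + 8 * m) * o) ⟩
  (5 + 4 * m) * (5 + 4 * m) * (m * o) + (9 + 8 * m) * o ≡⟨ lemma₁ m o ⟩
  suc m * ((3 + 4 * m) * (3 + 4 * m) * o)       ≤⟨ *-monoʳ-≤ (suc m) bound ⟩
  suc m * ((5 + 4 * m) * (5 + 4 * m) * s)       ≡⟨ lemma₂ m s ⟩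
  (5 + 4 * m) * (5 + 4 * m) * (suc m * s)       ∎)
  where
  open ≤-Reasoning
  lemma₁ : ∀ m o → (5 + 4 * m) * (5 + 4 * m) * (m * o) + (9 + 8 * m) * o
                   ≡ (1 + m) * ((3 + 4 * m) * (3 + 4 * m) * o)
  lemma₁ = solve-∀
  lemma₂ : ∀ m s → (1 + m) * ((5 + 4 * m) * (5 + 4 * m) * s) ≡ (5 + 4 * m) * (5 + 4 * m) * ((1 + m) * s)
  lemma₂ = solve-∀

-- The guarantee in rational numbers

α-≤ : ∀ {𝔾 : Graph n} m k → (∀ O → Independent 𝔾 O → m * ∣ O ∣ ≤ k) → m * α 𝔾 ≤ k
α-≤ {n} {𝔾} m k bound = argmax-all id {P = λ a → m * a ≤ k} (≤-trans (≤-reflexive (*-zeroʳ m)) z≤n)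
  (All.map⁺ (All.map (bound _) (All.all-filter (independent? 𝔾) (subsets n))))

-- A positive rational with denominator `m + 1` is at least `1 / (m + 1)`, so `1 - ε ≤ m / (m + 1)`.
approximation : ∀ ε a s → 0ℚ ℚ.< ε → let m = ℚ.denominator-1 ε in m * a ≤ suc m * s →
  (1ℚ ℚ.- ε) ℚ.* fromℕ a ℚ.≤ fromℕ s
approximation (mkℚ (+ 0) _ _)      a s (ℚ.*<* (ℤ.+<+ ())) _
approximation (mkℚ (-[1+ _ ]) _ _) a s (ℚ.*<* ()) _
approximation ε@(mkℚ (+ suc p) m _) a s 0<ε bound = ℚ.toℚᵘ-cancel-≤
  (ℚᵘ.≤-respˡ-≃ (ℚᵘ.≃-sym lhs) (ℚᵘ.≤-respʳ-≃ (ℚᵘ.≃-sym (ℚ.toℚᵘ-fromℚᵘ (mkℚᵘ (+ s) 0))) (ℚᵘ.*≤* core)))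
  where
  lhs : ℚ.toℚᵘ ((1ℚ ℚ.- ε) ℚ.* fromℕ a) ℚᵘ.≃ (1ℚᵘ ℚᵘ.- mkℚᵘ (+ suc p) m) ℚᵘ.* mkℚᵘ (+ a) 0
  lhs = ℚᵘ.≃-trans (ℚ.toℚᵘ-homo-* (1ℚ ℚ.- ε) (fromℕ a)) (ℚᵘ.*-cong
    (ℚᵘ.≃-trans (ℚ.toℚᵘ-homo-+ 1ℚ (ℚ.- ε)) (ℚᵘ.+-congʳ 1ℚᵘ (ℚ.toℚᵘ-homo‿- ε)))
    (ℚ.toℚᵘ-fromℚᵘ (mkℚᵘ (+ a) 0)))
  -- The factors 1 are the ones that unnormalised arithmetic leaves in numerators and denominators.
  core : (ℤ.1ℤ ℤ.* + suc m ℤ.+ -[1+ p ] ℤ.* ℤ.1ℤ) ℤ.* + a ℤ.* ℤ.1ℤ ℤ.≤ + s ℤ.* + (1 * suc m * 1)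
  core = begin
    (ℤ.1ℤ ℤ.* + suc m ℤ.+ -[1+ p ] ℤ.* ℤ.1ℤ) ℤ.* + a ℤ.* ℤ.1ℤ ≡⟨ units (+ suc m) -[1+ p ] (+ a) ⟩
    (+ suc m ℤ.+ -[1+ p ]) ℤ.* + a  ≤⟨ ℤ.*-monoʳ-≤-nonNeg (+ a) numerator≤ ⟩
    + m ℤ.* + a                     ≡⟨ ℤ.pos-* m a ⟨
    + (m * a)                       ≤⟨ ℤ.+≤+ bound ⟩
    + (suc m * s)                   ≡⟨ cong +_ (flipped m s) ⟩
    + (s * (1 * suc m * 1))         ≡⟨ ℤ.pos-* s _ ⟩
    + s ℤ.* + (1 * suc m * 1)       ∎
    where
    open ℤ.≤-Reasoning
    units : ∀ M k a → (ℤ.1ℤ ℤ.* M ℤ.+ k ℤ.* ℤ.1ℤ) ℤ.* a ℤ.* ℤ.1ℤ ≡ (M ℤ.+ k) ℤ.* a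
    units = ℤ-solve-∀
    flipped : ∀ m s → (1 + m) * s ≡ s * (1 * (1 + m) * 1)
    flipped = solve-∀
    numerator≤ : + suc m ℤ.+ -[1+ p ] ℤ.≤ + m
    numerator≤ = subst (ℤ._≤ + m) (sym (ℤ.[1+m]⊖[1+n]≡m⊖n m p)) (ℤ.m⊖n≤m m p)

-- The algorithm on encoded inputs

encodeGraph-rows : ∀ (𝔾 : Graph n) → encodeRows (adjacency 𝔾) ≡ encodeGraph 𝔾
encodeGraph-rows {n} 𝔾 = encodeList-tabulate adj
  where
  open Graph 𝔾
  encodeList-tabulate : ∀ {k} (h : Fin k → Fin n → Bool) →
    encodeRows (tabulate h) ≡ encodeList (encodeList encodeBool) (tabulate (λ u → tabulate (h u)))
  encodeList-tabulate {zero}  h = refl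
  encodeList-tabulate {suc k} h = cong (bits (h Fin.zero) ∙_) (encodeList-tabulate (h ∘ Fin.suc))

length≤size : ∀ {A : Set} (f : A → Tree) xs → length xs ≤ size (encodeList f xs)
length≤size f []       = z≤n
length≤size f (x ∷ xs) = s≤s (≤-trans (length≤size f xs) (m≤n+m _ _))

program : ℕ → Program
program d = record { extraVariables = 10 ; body = localSearch d }

program-outputs : ∀ d p → (∀ n → localSearchTime n d ≤ eval p n) →
  ∀ {n} (𝔾 : Graph n) (R : VPGRepresentation 𝔾) (L : IntersectionLists R) →
  program d on encodeInput R L outputs encodeSubset (searchResult 𝔾 d)
    within eval p (size (encodeInput R L))
program-outputs d p time≤ {n} 𝔾 R L =
  final , proj₁ runs , proj₁ (proj₂ runs) , refl ,
  ≤-trans (proj₂ (proj₂ runs)) (≤-trans (time≤ n) (eval-mono p n≤size))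
  where
  open ≤-Reasoning
  final : Store 11
  final = encodeSubset (searchResult 𝔾 d) ∷ encodeRows (adjacency 𝔾) ∷ Vec.replicate 9 nil

  runs : localSearch d from encodeInput R L ∷ Vec.replicate 10 nil to final within localSearchTime n d
  runs = subst (λ g → localSearch d from (g ∙ encodeRepresentation R L) ∷ Vec.replicate 10 nil to final
                        within localSearchTime n d)
    (encodeGraph-rows 𝔾)
    (localSearch-runs (adjacency 𝔾) (length-adjacency 𝔾) d (encodeRepresentation R L))

  -- The adjacency matrix alone has `n` rows, so a time bound in `n` is also one in the input size.
  n≤size : n ≤ size (encodeInput R L)
  n≤size = begin
    n                                      ≡⟨ length-adjacency 𝔾 ⟨
    length (adjacency 𝔾)                   ≤⟨ length≤size bits (adjacency 𝔾) ⟩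
    size (encodeRows (adjacency 𝔾))        ≡⟨ cong size (encodeGraph-rows 𝔾) ⟩
    size (encodeGraph 𝔾)                   ≤⟨ m≤m+n _ _ ⟩
    size (encodeGraph 𝔾) + size (encodeRepresentation R L) ≤⟨ n≤1+n _ ⟩
    size (encodeInput R L)                 ∎

searchResult-ratio : ∀ {t c b n} {𝔾 : Graph n} {R : VPGRepresentation 𝔾} → 1 ≤ c → InClass t c b R →
  ∀ m z → z ≡ 3 + 4 * m → m * α 𝔾 ≤ suc m * ∣ searchResult 𝔾 (swapSize t c z) ∣
searchResult-ratio {t} {c} {𝔾 = 𝔾} {R} 1≤c R∈ m z z≡ = α-≤ {𝔾 = 𝔾} m _ λ O O-independent →
  ratio-of-scale m z ∣ O ∣ ∣ searchResult 𝔾 (swapSize t c z) ∣ z≡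
    -- Cancelling the strip factor `c` is where `1 ≤ c` enters.
    (*-cancelˡ-≤ c {{>-nonZero 1≤c}}
      (Ratio.ratio R load≤ length≤ z {S = searchResult 𝔾 (swapSize t c z)} O-independent
        (searchResult-swaps 𝔾 (swapSize t c z))))
  where open InClass R∈

localSearch-solves : ∀ (𝒞 : RepresentationClass) ε d →
  (∀ {n} {𝔾 : Graph n} {R : VPGRepresentation 𝔾} → 𝒞 R →
    (1ℚ ℚ.- ε) ℚ.* fromℕ (α 𝔾) ℚ.≤ fromℕ ∣ searchResult 𝔾 d ∣) →
  ∃[ A ] ∃[ time ] SolvesIndependentSet 𝒞 ε A time
localSearch-solves 𝒞 ε d ratio = program d , within-polynomial (localSearchTimeₚ d)
  where
  within-polynomial : PolyBounded (λ n → localSearchTime n d) →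
    ∃[ time ] SolvesIndependentSet 𝒞 ε (program d) time
  within-polynomial (p , time≤) = p , record
    { solves = λ 𝔾 R L R∈ → searchResult 𝔾 d , program-outputs d p time≤ 𝔾 R L ,
                            searchResult-independent 𝔾 d , ratio R∈ }

theorem12 : ∀ (t c : ℕ) → 1 ≤ c → ∀ (b : Polynomial) →
    IndependentSetAdmitsPTAS (InClass t c b)
theorem12 t c 1≤c b ε 0<ε ε<1 = localSearch-solves (InClass t c b) ε (swapSize t c (3 + 4 * m))
  λ {_} {𝔾} R∈ → approximation ε (α 𝔾) ∣ searchResult 𝔾 (swapSize t c (3 + 4 * m)) ∣ 0<ε (searchResult-ratio 1≤c R∈ m (3 + 4 * m) refl)
  where
  m : ℕ
  m = ℚ.denominator-1 ε
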